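{- Let $S_n$ be the star on $n$ vertices with edge set $E$, let $f=\{i,j\}\notin E$ be a pair of distinct vertices of $S_n$, and let $B=E\cup\{f\}$. Then the eigenvalues of $\mathfrak{D}_2(S_n)[B,B]$ are $-1$ with multiplicity $n-3$, together with the roots of the cubic polynomial $g(x)=x^3-2(n-1)x^2-7(n-2)x-(n-1)$.
   Context: For a tree $T$, let $\mathcal{V}_2$ be the set of 2-element vertex subsets (edges regarded as elements of $\mathcal{V}_2$). The 2-Steiner distance matrix $\mathfrak{D}_2(T)$ is indexed by $\mathcal{V}_2$, with entry in row $\{i,j\}$, column $\{k,l\}$ equal to the minimum number of edges of a connected subtree of $T$ whose vertex set contains $i,j,k,l$. $M[B,B]$ denotes the principal submatrix with rows and columns indexed by $B$. -}

module Defs where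

open import Level using (_⊔_)
open import Algebra.Apartness.Bundles using (HeytingField; HeytingCommutativeRing)
open import Algebra.Bundles using (CommutativeRing)
open import Algebra.Bundles.Raw using (RawRing)
import Algebra.Definitions.RawSemiring as RawSemiringDefs
open import Data.Bool.Base using (if_then_else_)
open import Data.Empty using (⊥)
open import Data.Fin.Base using (Fin; zero; suc; toℕ; fromℕ; inject₁; punchIn)
open import Data.Fin.Properties using (_≟_; any?; all?)
open import Data.Fin.Subset using (Subset; inside; _∈_; _⊆_; _∪_; ⁅_⁆; ⊤; ∣_∣; Nonempty)
open import Data.Fin.Subset.Properties using (_∈?_; _⊆?_; nonempty?; anySubset?; ∈⊤; ⊆⊤; ∣⁅x⁆∣≡1; x∈⁅x⁆; x∈⁅y⁆⇒x≡y)
open import Data.List.Base as List using (List; []; _∷_; allFin)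
open import Data.List.Membership.Propositional using () renaming (_∈_ to _∈ˡ_)
open import Data.List.Membership.Propositional.Properties using (∈-allFin)
open import Data.List.Relation.Unary.Any using (here; there)
open import Data.Nat.Base as ℕ using (ℕ; zero; suc; _∸_; _≤_; z≤n; s≤s; NonZero)
import Data.Nat.Properties as ℕ
open import Data.Product.Base using (∃; _×_; _,_; proj₁; proj₂)
open import Data.Sum.Base using (_⊎_; inj₁; inj₂)
open import Data.Vec.Functional as Vector using (Vector)
import Data.Vec.Base as V
open import Function.Definitions using (Injective)
open import Relation.Binary.Construct.Closure.ReflexiveTransitive using (Star; ε; _◅_; _◅◅_)
open import Relation.Binary.Core using (Rel)
open import Relation.Binary.Definitions using (Decidable)
open import Relation.Binary.PropositionalEquality using (_≡_; _≢_; refl; sym; trans; cong; subst)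
open import Relation.Nullary.Decidable using (Dec; yes; no; does; map′; ¬?; _×-dec_; _⊎-dec_; _→-dec_)
open import Relation.Nullary.Negation using (¬_; contradiction)

-- Decidability of reachability and existence of minima, used only to
-- turn the Steiner distance into a function.

module Reachability {n ℓ} {R : Rel (Fin n) ℓ} (R? : Decidable R) where

  -- Warshall: walks all of whose interior vertices lie in the given list.
  Via : List (Fin n) → Rel (Fin n) ℓ
  Via []       u v = u ≡ v ⊎ R u v
  Via (x ∷ xs) u v = Via xs u v ⊎ (Via xs u x × Via xs x v)

  via? : ∀ xs → Decidable (Via xs)
  via? []       u v = (u ≟ v) ⊎-dec R? u v
  via? (x ∷ xs) u v = via? xs u v ⊎-dec (via? xs u x ×-dec via? xs x v)

  via⇒star : ∀ xs {u v} → Via xs u v → Star R u v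
  via⇒star []       (inj₁ refl)    = ε
  via⇒star []       (inj₂ r)       = r ◅ ε
  via⇒star (x ∷ xs) (inj₁ p)       = via⇒star xs p
  via⇒star (x ∷ xs) (inj₂ (p , q)) = via⇒star xs p ◅◅ via⇒star xs q

  via-base : ∀ xs {u v} → u ≡ v ⊎ R u v → Via xs u v
  via-base []       r = r
  via-base (x ∷ xs) r = inj₁ (via-base xs r)

  via-trans : ∀ xs {u w v} → w ∈ˡ xs → Via xs u w → Via xs w v → Via xs u v
  via-trans (x ∷ xs) (here refl) p q = inj₂ (into p , from q)
    where
    into : ∀ {u} → Via (x ∷ xs) u x → Via xs u x
    into (inj₁ p)       = p
    into (inj₂ (p , _)) = p
    from : ∀ {v} → Via (x ∷ xs) x v → Via xs x v
    from (inj₁ q)       = q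
    from (inj₂ (_ , q)) = q
  via-trans (x ∷ xs) (there w∈) (inj₁ p)       (inj₁ q)       = inj₁ (via-trans xs w∈ p q)
  via-trans (x ∷ xs) (there w∈) (inj₁ p)       (inj₂ (q , r)) = inj₂ (via-trans xs w∈ p q , r)
  via-trans (x ∷ xs) (there w∈) (inj₂ (o , p)) (inj₁ q)       = inj₂ (o , via-trans xs w∈ p q)
  via-trans (x ∷ xs) (there w∈) (inj₂ (o , _)) (inj₂ (_ , r)) = inj₂ (o , r)

  star⇒via : ∀ {u v} → Star R u v → Via (allFin n) u v
  star⇒via ε        = via-base (allFin n) (inj₁ refl)
  star⇒via (r ◅ rs) =
    via-trans (allFin n) (∈-allFin _) (via-base (allFin n) (inj₂ r)) (star⇒via rs)

  star? : Decidable (Star R)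
  star? u v = map′ (via⇒star (allFin n)) star⇒via (via? (allFin n) u v)

Minimum : ∀ {ℓ} → (ℕ → Set ℓ) → ℕ → Set ℓ
Minimum P d = P d × (∀ k → P k → d ≤ k)

minimum : ∀ {ℓ} {P : ℕ → Set ℓ} → (∀ k → Dec (P k)) → ∀ k → P k → ∃ (Minimum P)
minimum P? zero p = zero , p , λ _ _ → z≤n
minimum {P = P} P? (suc k) p with P? zero
... | yes p₀ = zero , p₀ , λ _ _ → z≤n
... | no ¬p₀ with minimum {P = λ j → P (suc j)} (λ j → P? (suc j)) k p
...   | d , q , least = suc d , q , λ where
          zero    p₀ → contradiction p₀ ¬p₀
          (suc j) pⱼ → s≤s (least j pⱼ)

-- The cardinality proof is irrelevant, so equality of pairs is equality
-- of their vertex sets.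
record 𝒱₂ (n : ℕ) : Set where
  constructor mk𝒱₂
  field
    vertices : Subset n
    .card    : ∣ vertices ∣ ≡ 2

open 𝒱₂ public

record Graph (n : ℕ) : Set where
  field
    size     : ℕ
    edge     : Vector (𝒱₂ n) size
    distinct : Injective _≡_ _≡_ edge

  -- A subgraph is given by its vertex set U and its set F of edges.

  Adjacent : Subset size → Rel (Fin n) _
  Adjacent F u v = u ≢ v × ∃ λ e → e ∈ F × u ∈ vertices (edge e) × v ∈ vertices (edge e)

  IsSubgraph : Subset n → Subset size → Set
  IsSubgraph U F = ∀ e → e ∈ F → vertices (edge e) ⊆ U

  IsConnected : Subset n → Subset size → Set
  IsConnected U F = Nonempty U × (∀ u v → u ∈ U → v ∈ U → Star (Adjacent F) u v)

  record Cycle : Set where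
    field
      {k}         : ℕ
      vertex      : Vector (Fin n) (3 ℕ.+ k)
      injective   : Injective _≡_ _≡_ vertex
      consecutive : ∀ i → Adjacent ⊤ (vertex (inject₁ i)) (vertex (suc i))
      closing     : Adjacent ⊤ (vertex (fromℕ (2 ℕ.+ k))) (vertex zero)

record Tree (n : ℕ) : Set where
  field
    graph : Graph n
  open Graph graph public
  field
    connected : IsConnected ⊤ ⊤
    acyclic   : ¬ Cycle

module _ {n : ℕ} (T : Tree n) where
  open Tree T

  -- A tree has no cycles, so its subtrees are its connected subgraphs.
  IsSubtreeContaining : Subset n → Subset n → Subset size → Set
  IsSubtreeContaining S U F = IsSubgraph U F × IsConnected U F × S ⊆ U

  SubtreeWithEdges : Subset n → ℕ → Set
  SubtreeWithEdges S d = ∃ λ U → ∃ λ F → IsSubtreeContaining S U F × ∣ F ∣ ≡ d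

  adjacent? : ∀ F → Decidable (Adjacent F)
  adjacent? F u v = ¬? (u ≟ v) ×-dec
    any? λ e → (e ∈? F) ×-dec ((u ∈? vertices (edge e)) ×-dec (v ∈? vertices (edge e)))

  isSubtreeContaining? : ∀ S U F → Dec (IsSubtreeContaining S U F)
  isSubtreeContaining? S U F =
    all? (λ e → (e ∈? F) →-dec (vertices (edge e) ⊆? U))
    ×-dec (nonempty? U ×-dec all? λ u → all? λ v →
      (u ∈? U) →-dec ((v ∈? U) →-dec Reachability.star? (adjacent? F) u v))
    ×-dec (S ⊆? U)

  subtreeWithEdges? : ∀ S d → Dec (SubtreeWithEdges S d)
  subtreeWithEdges? S d = anySubset? λ U → anySubset? λ F →
    isSubtreeContaining? S U F ×-dec (∣ F ∣ ℕ.≟ d)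

  wholeTree : ∀ S → SubtreeWithEdges S ∣ ⊤ {size} ∣
  wholeTree S = ⊤ , ⊤ , ((λ _ _ → ⊆⊤) , connected , ⊆⊤) , refl

  steinerMinimum : ∀ S → ∃ (Minimum (SubtreeWithEdges S))
  steinerMinimum S = minimum (subtreeWithEdges? S) _ (wholeTree S)

  steinerDistance : Subset n → ℕ
  steinerDistance S = proj₁ (steinerMinimum S)

  steinerDistance-minimum : ∀ S → Minimum (SubtreeWithEdges S) (steinerDistance S)
  steinerDistance-minimum S = proj₂ (steinerMinimum S)

  𝔇₂ : 𝒱₂ n → 𝒱₂ n → ℕ
  𝔇₂ p q = steinerDistance (vertices p ∪ vertices q)

-- The edge {0 , i + 1}; the centre of the star is vertex zero.
spoke : ∀ {m} → Fin m → 𝒱₂ (suc m)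
spoke i = mk𝒱₂ (inside V.∷ ⁅ i ⁆) (cong suc (∣⁅x⁆∣≡1 i))

spoke-injective : ∀ {m} → Injective _≡_ _≡_ (spoke {m})
spoke-injective {x = i} {j} eq =
  x∈⁅y⁆⇒x≡y j (subst (i ∈_) (cong (λ p → V.tail (vertices p)) eq) (x∈⁅x⁆ i))

starGraph : ∀ m → Graph (suc m)
starGraph m = record { size = m ; edge = spoke ; distinct = spoke-injective }

module _ {m : ℕ} where
  open Graph (starGraph m)

  private
    out : ∀ i → Adjacent ⊤ zero (suc i)
    out i = (λ ()) , i , ∈⊤ , V.here , V.there (x∈⁅x⁆ i)

    back : ∀ i → Adjacent ⊤ (suc i) zero
    back i = (λ ()) , i , ∈⊤ , V.there (x∈⁅x⁆ i) , V.here

    toCentre : ∀ u → Star (Adjacent ⊤) u zero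
    toCentre zero    = ε
    toCentre (suc i) = back i ◅ ε

    fromCentre : ∀ v → Star (Adjacent ⊤) zero v
    fromCentre zero    = ε
    fromCentre (suc i) = out i ◅ ε

    oneIsCentre : ∀ {u v} → Adjacent ⊤ u v → u ≡ zero ⊎ v ≡ zero
    oneIsCentre {zero}          _ = inj₁ refl
    oneIsCentre {suc _} {zero}  _ = inj₂ refl
    oneIsCentre {suc u} {suc v} (u≢v , e , _ , V.there u∈ , V.there v∈) =
      contradiction (cong suc (trans (x∈⁅y⁆⇒x≡y e u∈) (sym (x∈⁅y⁆⇒x≡y e v∈)))) u≢v

    clash : (c : Cycle) (let open Cycle c) → ∀ {i j} →
            i ≢ j → vertex i ≡ zero → vertex j ≡ zero → ⊥
    clash c i≢j p q = i≢j (Cycle.injective c (trans p (sym q)))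

  starGraph-connected : IsConnected ⊤ ⊤
  starGraph-connected = (zero , ∈⊤) , λ u v _ _ → toCentre u ◅◅ fromCentre v

  starGraph-acyclic : ¬ Cycle
  starGraph-acyclic c
    with oneIsCentre closing | oneIsCentre (consecutive zero) | oneIsCentre (consecutive (suc zero))
    where open Cycle c
  ... | inj₁ vₗ | inj₁ v₀ | _       = clash c (λ ()) vₗ v₀
  ... | inj₁ vₗ | inj₂ v₁ | _       = clash c (λ ()) vₗ v₁
  ... | inj₂ v₀ | _       | inj₁ v₁ = clash c (λ ()) v₀ v₁
  ... | inj₂ v₀ | _       | inj₂ v₂ = clash c (λ ()) v₀ v₂

star : ∀ n .{{_ : NonZero n}} → Tree n
star (suc m) = record
  { graph = starGraph m ; connected = starGraph-connected ; acyclic = starGraph-acyclic }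

Matrix : ∀ {a} → Set a → ℕ → Set a
Matrix A n = Fin n → Fin n → A

-- M[B,B], for b an enumeration without repetition of B.
principal : ∀ {a i} {A : Set a} {I : Set i} {n} → (I → I → A) → Vector I n → Matrix A n
principal M b i j = M (b i) (b j)

module _ {c ℓ} (R : RawRing c ℓ) where
  open RawRing R
  open RawSemiringDefs rawSemiring using (sum; _^_)

  -- Laplace expansion along the first row.
  det : ∀ {n} → Matrix Carrier n → Carrier
  det {zero}  M = 1#
  det {suc n} M = sum λ j →
    (- 1#) ^ toℕ j * (M zero j * det (λ r s → M (suc r) (punchIn j s)))

module Polynomial {c ℓ} (R : RawRing c ℓ) where
  open RawRing R

  -- Coefficients by increasing degree; _≈ₚ_ ignores trailing zeros.
  Poly : Set c
  Poly = List Carrier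

  coeff : Poly → ℕ → Carrier
  coeff []      _       = 0#
  coeff (a ∷ p) zero    = a
  coeff (a ∷ p) (suc k) = coeff p k

  infix 4 _≈ₚ_
  _≈ₚ_ : Rel Poly ℓ
  p ≈ₚ q = ∀ k → coeff p k ≈ coeff q k

  _+ₚ_ : Poly → Poly → Poly
  []      +ₚ q       = q
  (a ∷ p) +ₚ []      = a ∷ p
  (a ∷ p) +ₚ (b ∷ q) = (a + b) ∷ (p +ₚ q)

  _*ₚ_ : Poly → Poly → Poly
  []      *ₚ q = []
  (a ∷ p) *ₚ q = List.map (a *_) q +ₚ (0# ∷ (p *ₚ q))

  eval : Poly → Carrier → Carrier
  eval []      x = 0#
  eval (a ∷ p) x = a + x * eval p x

  constant : Carrier → Poly
  constant a = a ∷ []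

  X : Poly
  X = 0# ∷ 1# ∷ []

  polyRing : RawRing c ℓ
  polyRing = record
    { Carrier = Poly
    ; _≈_     = _≈ₚ_
    ; _+_     = _+ₚ_
    ; _*_     = _*ₚ_
    ; -_      = List.map -_
    ; 0#      = []
    ; 1#      = constant 1#
    }

  charPoly : ∀ {n} → Matrix Carrier n → Poly
  charPoly M = det polyRing λ i j →
    (if does (i ≟ j) then X else []) +ₚ constant (- M i j)

-- Eigenvalues over a field. A classical field is a Heyting field whose
-- apartness is the negation of equality.

module Spectrum {c ℓ₁ ℓ₂} (K : HeytingField c ℓ₁ ℓ₂) where
  open HeytingField K

  rawRing : RawRing c ℓ₁
  rawRing = CommutativeRing.rawRing
    (HeytingCommutativeRing.commutativeRing (HeytingField.heytingCommutativeRing K))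

  open RawSemiringDefs (RawRing.rawSemiring rawRing) using (sum) renaming (_×_ to _·_)
  open Polynomial rawRing public
  open RawSemiringDefs (RawRing.rawSemiring polyRing) public using () renaming (_^_ to _^ₚ_)

  natural : ℕ → Carrier
  natural k = k · 1#

  CharacteristicZero : Set ℓ₂
  CharacteristicZero = ∀ k → natural (suc k) # 0#

  toMatrix : ∀ {n} → Matrix ℕ n → Matrix Carrier n
  toMatrix M i j = natural (M i j)

  IsEigenvalue : ∀ {n} → Matrix Carrier n → Carrier → Set (c ⊔ ℓ₁ ⊔ ℓ₂)
  IsEigenvalue {n} M x = ∃ λ (v : Vector Carrier n) →
    (∃ λ i → v i # 0#) × (∀ i → sum (λ j → M i j * v j) ≈ x * v i)

  -- x³ − 2(n−1)x² − 7(n−2)x − (n−1); the truncated subtractions are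
  -- exact for n ≥ 2.
  g : ℕ → Poly
  g n = - natural (n ∸ 1)
      ∷ - natural (7 ℕ.* (n ∸ 2))
      ∷ - natural (2 ℕ.* (n ∸ 1))
      ∷ 1#
      ∷ []

{-# OPTIONS --safe #-}

-- For f = {i , j} a pair of leaves, the matrix has entry 2 at (f , f), 2 or 3
-- at (f , e) according to whether the leaf of e lies in f, 1 on the diagonal of
-- the edges and 2 off it.  Put y = x + 1.  Expanding det (x I − M) along row f
-- leaves determinants of y I − 2 J with at most one column replaced, i.e. of
-- diagonal matrices perturbed by a matrix of rank two, for which
--   det (D + U Vᵀ) = Σ_{|S| ≤ 2} det (U_S V_Sᵀ) ∏_{i ∉ S} dᵢ .
-- For the eigenvalues themselves, an eigenvector v is determined by its entry at
-- f and the sum S of the others: y vₖ is a combination of these two, and g(x)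
-- annihilates both.  Conversely eᵢ − eⱼ belongs to −1, and a root of g has an
-- eigenvector constant on {i , j} and on the remaining leaves.  Equality in the
-- field need not be decidable; the case distinctions use g(−1) = 4 (n − 3).
module Submission where

open import Algebra.Apartness.Bundles using (HeytingCommutativeRing; HeytingField)
open import Algebra.Bundles using (CommutativeRing)
import Algebra.Solver.Ring
open import Algebra.Solver.Ring.AlmostCommutativeRing using (fromCommutativeRing; _-Raw-AlmostCommutative⟶_)
open import Data.Bool.Base using (true; false; if_then_else_)
open import Data.Fin.Base using (Fin; zero; suc; toℕ; punchIn; pinch)
open import Data.Fin.Properties using (_≟_; suc-injective)
open import Data.Fin.Subset using (Subset; inside; outside; _∈_; _⊆_; _∪_; ⁅_⁆; ∣_∣; ⊥; ∁; Nonempty)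
open import Data.Fin.Subset.Properties using (x∈⁅x⁆; x∈⁅y⁆⇒x≡y; ∣⁅x⁆∣≡1; p⊆q⇒∣p∣≤∣q∣; ∪-identityʳ; ∪-idem; ∪-comm; ∣∁p∣≡n∸∣p∣; ∣p∣≤n)
open import Data.Integer.Base as ℤ using (ℤ; +_; -[1+_])
import Data.Integer.Properties as ℤ
import Data.List.Base as List
open import Data.Maybe.Base using (Maybe; just; nothing)
open import Data.Nat.Base as ℕ using (ℕ; zero; suc; NonZero; _∸_; _≤_; _<_)
import Data.Nat.Properties as ℕ
open import Data.Product.Base using (∃; _×_; _,_; proj₁)
open import Data.Sum.Base using (_⊎_; inj₁; inj₂; [_,_]′; map)
import Data.Vec.Base as Vec
open import Data.Vec.Functional as Vector using (Vector; insertAt; updateAt; removeAt)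
open import Data.Vec.Functional.Properties using (insertAt-lookup; insertAt-punchIn; updateAt-updates; updateAt-minimal)
open import Data.Vec.Properties using (lookup-replicate; []=⇒lookup)
open import Function.Base using (_∘_; const; id)
open import Function.Bundles using (_⇔_; mk⇔; Equivalence)
open import Relation.Binary.Bundles using (Setoid)
open import Relation.Binary.Construct.Closure.ReflexiveTransitive using (Star; ε; _◅_; _◅◅_)
open import Relation.Binary.PropositionalEquality as ≡ using (_≡_; _≢_; cong; cong₂; subst)
open import Relation.Binary.Structures using (IsEquivalence)
open import Relation.Nullary.Decidable using (does; yes; no; recompute)
open import Relation.Nullary.Negation using (contradiction)
open import Defs

-- `charPoly` is a determinant over polynomials, where diagonal entries have no inverses, and each
-- minor with a replaced column has a zero on its diagonal. Factoring out det D is therefore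
-- impossible; the rank-two expansion is written with products that leave out one or two diagonal
-- entries, which is valid over every commutative ring and for every diagonal. The characteristic
-- polynomial is the instance x = `X`. The eigenvalues are not read off from that polynomial. The
-- partition of B into {f}, the two spokes ending in f and the remaining spokes gives a 3 × 3 system
-- with determinant g(x). Its cofactors prove that g(x) annihilates the class data of an
-- eigenvector, and a cross product of two rows gives an eigenvector at a root. The exceptional case
-- is n = 3: the third class is empty, the quotient is 2 × 2 with characteristic polynomial `q`, and
-- g = (x + 1) `q`. There -1 is an eigenvalue although its separate multiplicity n - 3 is zero.

-- Integer coefficients for the ring solver.

module IntegerCoefficients {c ℓ} (R : CommutativeRing c ℓ) where
  open CommutativeRing R
  open import Algebra.Properties.Semiring.Mult semiring using (×-homo-+; ×1-homo-*) renaming (_×_ to _·_)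
  open import Algebra.Properties.Ring ring using (-‿distribˡ-*; -‿distribʳ-*; -‿involutive; -0#≈0#)
  open import Algebra.Properties.AbelianGroup +-abelianGroup using (⁻¹-∙-comm)
  open import Relation.Binary.Reasoning.Setoid setoid

  ⟦_⟧× : ℤ → Carrier
  ⟦ + n ⟧×      = n · 1#
  ⟦ -[1+ n ] ⟧× = - (suc n · 1#)

  -- Reading 1 as 1#, not 1# + 0#, lets solver literals match goals definitionally.
  ⟦_⟧ℤ : ℤ → Carrier
  ⟦ + 1 ⟧ℤ = 1#
  ⟦ i   ⟧ℤ = ⟦ i ⟧×

  private
    neg-homo : ∀ i → ⟦ ℤ.- i ⟧× ≈ - ⟦ i ⟧×
    neg-homo (+ zero)  = sym -0#≈0#
    neg-homo (+ suc n) = refl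
    neg-homo -[1+ n ]  = sym (-‿involutive _)

    1+a-1-b : ∀ a b → a - b ≈ (1# + a) - (1# + b)
    1+a-1-b a b = sym (begin
      (1# + a) + - (1# + b)     ≈⟨ +-cong (+-comm 1# a) (sym (⁻¹-∙-comm 1# b)) ⟩
      (a + 1#) + (- 1# + - b)   ≈⟨ +-assoc a 1# _ ⟩
      a + (1# + (- 1# + - b))   ≈⟨ +-congˡ (+-assoc 1# (- 1#) (- b)) ⟨
      a + ((1# + - 1#) + - b)   ≈⟨ +-congˡ (+-congʳ (-‿inverseʳ 1#)) ⟩
      a + (0# + - b)            ≈⟨ +-congˡ (+-identityˡ _) ⟩
      a - b                     ∎)

    ⊖-homo : ∀ m n → ⟦ m ℤ.⊖ n ⟧× ≈ m · 1# - n · 1#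
    ⊖-homo m       zero    = sym (trans (+-congˡ -0#≈0#) (+-identityʳ _))
    ⊖-homo zero    (suc n) = sym (+-identityˡ _)
    ⊖-homo (suc m) (suc n) = begin
      ⟦ suc m ℤ.⊖ suc n ⟧×         ≡⟨ ≡.cong ⟦_⟧× (ℤ.[1+m]⊖[1+n]≡m⊖n m n) ⟩
      ⟦ m ℤ.⊖ n ⟧×                 ≈⟨ ⊖-homo m n ⟩
      m · 1# - n · 1#              ≈⟨ 1+a-1-b _ _ ⟩
      suc m · 1# - suc n · 1#      ∎

    +-homo : ∀ i j → ⟦ i ℤ.+ j ⟧× ≈ ⟦ i ⟧× + ⟦ j ⟧×
    +-homo (+ m)    (+ n)    = ×-homo-+ 1# m n
    +-homo (+ m)    -[1+ n ] = ⊖-homo m (suc n)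
    +-homo -[1+ m ] (+ n)    = trans (⊖-homo n (suc m)) (+-comm _ _)
    +-homo -[1+ m ] -[1+ n ] = begin
      - (suc (suc (m ℕ.+ n)) · 1#)       ≡⟨ ≡.cong (λ k → - (suc k · 1#)) (ℕ.+-suc m n) ⟨
      - ((suc m ℕ.+ suc n) · 1#)         ≈⟨ -‿cong (×-homo-+ 1# (suc m) (suc n)) ⟩
      - (suc m · 1# + suc n · 1#)        ≈⟨ ⁻¹-∙-comm _ _ ⟨
      - (suc m · 1#) + - (suc n · 1#)    ∎

    *-homo⁺ : ∀ m j → ⟦ + m ℤ.* j ⟧× ≈ m · 1# * ⟦ j ⟧×
    *-homo⁺ m (+ n)    = begin
      ⟦ + m ℤ.* + n ⟧×           ≡⟨ ≡.cong ⟦_⟧× (ℤ.pos-* m n) ⟨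
      (m ℕ.* n) · 1#             ≈⟨ ×1-homo-* m n ⟩
      m · 1# * n · 1#            ∎
    *-homo⁺ m -[1+ n ] = begin
      ⟦ + m ℤ.* -[1+ n ] ⟧×        ≡⟨ ≡.cong ⟦_⟧× (ℤ.neg-distribʳ-* (+ m) (+ suc n)) ⟨
      ⟦ ℤ.- (+ m ℤ.* + suc n) ⟧×   ≈⟨ neg-homo (+ m ℤ.* + suc n) ⟩
      - ⟦ + m ℤ.* + suc n ⟧×       ≈⟨ -‿cong (*-homo⁺ m (+ suc n)) ⟩
      - (m · 1# * suc n · 1#)      ≈⟨ -‿distribʳ-* _ _ ⟩
      m · 1# * - (suc n · 1#)      ∎

    *-homo : ∀ i j → ⟦ i ℤ.* j ⟧× ≈ ⟦ i ⟧× * ⟦ j ⟧×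
    *-homo (+ m)    j = *-homo⁺ m j
    *-homo -[1+ m ] j = begin
      ⟦ -[1+ m ] ℤ.* j ⟧×          ≡⟨ ≡.cong ⟦_⟧× (ℤ.neg-distribˡ-* (+ suc m) j) ⟨
      ⟦ ℤ.- (+ suc m ℤ.* j) ⟧×     ≈⟨ neg-homo (+ suc m ℤ.* j) ⟩
      - ⟦ + suc m ℤ.* j ⟧×         ≈⟨ -‿cong (*-homo⁺ (suc m) j) ⟩
      - (suc m · 1# * ⟦ j ⟧×)      ≈⟨ -‿distribˡ-* _ _ ⟩
      - (suc m · 1#) * ⟦ j ⟧×      ∎

    ⟦⟧ℤ≈⟦⟧× : ∀ i → ⟦ i ⟧ℤ ≈ ⟦ i ⟧×
    ⟦⟧ℤ≈⟦⟧× (+ 0)           = refl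
    ⟦⟧ℤ≈⟦⟧× (+ 1)           = sym (+-identityʳ 1#)
    ⟦⟧ℤ≈⟦⟧× (+ suc (suc n)) = refl
    ⟦⟧ℤ≈⟦⟧× -[1+ n ]        = refl

    morphism : ℤ.+-*-rawRing -Raw-AlmostCommutative⟶ fromCommutativeRing R
    morphism = record
      { ⟦_⟧    = ⟦_⟧ℤ
      ; +-homo = λ i j → trans (⟦⟧ℤ≈⟦⟧× (i ℤ.+ j)) (trans (+-homo i j)
                   (sym (+-cong (⟦⟧ℤ≈⟦⟧× i) (⟦⟧ℤ≈⟦⟧× j))))
      ; *-homo = λ i j → trans (⟦⟧ℤ≈⟦⟧× (i ℤ.* j)) (trans (*-homo i j)
                   (sym (*-cong (⟦⟧ℤ≈⟦⟧× i) (⟦⟧ℤ≈⟦⟧× j))))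
      ; -‿homo = λ i → trans (⟦⟧ℤ≈⟦⟧× (ℤ.- i)) (trans (neg-homo i) (-‿cong (sym (⟦⟧ℤ≈⟦⟧× i))))
      ; 0-homo = refl
      ; 1-homo = refl
      }

    -- The solver asks only for soundness, so comparing integers suffices even in rings where
    -- distinct integers have equal images.
    coeff≟ : ∀ i j → Maybe (⟦ i ⟧ℤ ≈ ⟦ j ⟧ℤ)
    coeff≟ i j with i ℤ.≟ j
    ... | yes ≡.refl = just refl
    ... | no  _      = nothing

  open Algebra.Solver.Ring ℤ.+-*-rawRing (fromCommutativeRing R) morphism coeff≟ public
    using (solve; _:=_; _:+_; _:*_; _:-_; :-_; con)

-- The commutative ring of polynomials.

module PolynomialRing {c ℓ} (R : CommutativeRing c ℓ) where
  open import Data.List.Base using ([]; _∷_)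
  open CommutativeRing R hiding (zero)
  open Polynomial rawRing
  open IntegerCoefficients R
  open import Algebra.Properties.Ring ring using (-0#≈0#)

  -- A record copy of _≈ₚ_, from which the two polynomials can be inferred.
  infix 4 _≋_
  record _≋_ (p q : Poly) : Set ℓ where
    constructor coeffwise
    field at : p ≈ₚ q
  open _≋_

  ≋-isEquivalence : IsEquivalence _≋_
  ≋-isEquivalence = record
    { refl  = coeffwise λ _ → refl
    ; sym   = λ p≋q → coeffwise λ k → sym (at p≋q k)
    ; trans = λ p≋q q≋r → coeffwise λ k → trans (at p≋q k) (at q≋r k)
    }

  private
    polySetoid : Setoid c ℓ
    polySetoid = record { isEquivalence = ≋-isEquivalence }
    module ≋ = Setoid polySetoid

  open import Relation.Binary.Reasoning.Setoid polySetoid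

  scale : Carrier → Poly → Poly
  scale a = List.map (a *_)

  coeff-+ₚ : ∀ p q k → coeff (p +ₚ q) k ≈ coeff p k + coeff q k
  coeff-+ₚ []      q       k       = sym (+-identityˡ _)
  coeff-+ₚ (a ∷ p) []      k       = sym (+-identityʳ _)
  coeff-+ₚ (a ∷ p) (b ∷ q) zero    = refl
  coeff-+ₚ (a ∷ p) (b ∷ q) (suc k) = coeff-+ₚ p q k

  coeff-scale : ∀ a p k → coeff (scale a p) k ≈ a * coeff p k
  coeff-scale a []      k       = sym (zeroʳ a)
  coeff-scale a (b ∷ p) zero    = refl
  coeff-scale a (b ∷ p) (suc k) = coeff-scale a p k

  negₚ : Poly → Poly
  negₚ = List.map (-_)

  coeff-neg : ∀ p k → coeff (negₚ p) k ≈ - coeff p k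
  coeff-neg []      k       = sym -0#≈0#
  coeff-neg (a ∷ p) zero    = refl
  coeff-neg (a ∷ p) (suc k) = coeff-neg p k

  ∷-cong : ∀ {a b p q} → a ≈ b → p ≋ q → a ∷ p ≋ b ∷ q
  ∷-cong a≈b p≈q = coeffwise λ { zero → a≈b ; (suc k) → at p≈q k }

  0∷[]≈[] : 0# ∷ [] ≋ []
  0∷[]≈[] = coeffwise λ { zero → refl ; (suc k) → refl }

  +ₚ-cong : ∀ {p p′ q q′} → p ≋ p′ → q ≋ q′ → p +ₚ q ≋ p′ +ₚ q′
  +ₚ-cong {p} {p′} {q} {q′} p≈p′ q≈q′ = coeffwise λ k →
    trans (coeff-+ₚ p q k) (trans (+-cong (at p≈p′ k) (at q≈q′ k)) (sym (coeff-+ₚ p′ q′ k)))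

  +ₚ-congˡ : ∀ {p q q′} → q ≋ q′ → p +ₚ q ≋ p +ₚ q′
  +ₚ-congˡ = +ₚ-cong ≋.refl

  +ₚ-assoc : ∀ p q r → (p +ₚ q) +ₚ r ≋ p +ₚ (q +ₚ r)
  +ₚ-assoc p q r = coeffwise λ k →
    trans (coeff-+ₚ (p +ₚ q) r k) (trans (+-congʳ (coeff-+ₚ p q k)) (trans (+-assoc _ _ _)
      (sym (trans (coeff-+ₚ p (q +ₚ r) k) (+-congˡ (coeff-+ₚ q r k))))))

  +ₚ-comm : ∀ p q → p +ₚ q ≋ q +ₚ p
  +ₚ-comm p q = coeffwise λ k → trans (coeff-+ₚ p q k) (trans (+-comm _ _) (sym (coeff-+ₚ q p k)))

  +ₚ-identityʳ : ∀ p → p +ₚ [] ≋ p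
  +ₚ-identityʳ []      = ≋.refl
  +ₚ-identityʳ (a ∷ p) = ≋.refl

  +ₚ-interchange : ∀ p q r s → (p +ₚ q) +ₚ (r +ₚ s) ≋ (p +ₚ r) +ₚ (q +ₚ s)
  +ₚ-interchange p q r s = coeffwise λ k → trans (expand p q r s k) (trans
    (solve 4 (λ p q r s → (p :+ q) :+ (r :+ s) := (p :+ r) :+ (q :+ s)) refl _ _ _ _)
    (sym (expand p r q s k)))
    where
    expand : ∀ p q r s k → coeff ((p +ₚ q) +ₚ (r +ₚ s)) k ≈ (coeff p k + coeff q k) + (coeff r k + coeff s k)
    expand p q r s k = trans (coeff-+ₚ (p +ₚ q) (r +ₚ s) k) (+-cong (coeff-+ₚ p q k) (coeff-+ₚ r s k))

  neg-inverseˡ : ∀ p → negₚ p +ₚ p ≋ []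
  neg-inverseˡ p = coeffwise λ k →
    trans (coeff-+ₚ (negₚ p) p k) (trans (+-congʳ (coeff-neg p k)) (-‿inverseˡ _))

  scale-cong : ∀ {a b p q} → a ≈ b → p ≋ q → scale a p ≋ scale b q
  scale-cong {a} {b} {p} {q} a≈b p≈q = coeffwise λ k →
    trans (coeff-scale a p k) (trans (*-cong a≈b (at p≈q k)) (sym (coeff-scale b q k)))

  scale-distrib-+ₚ : ∀ a p q → scale a (p +ₚ q) ≋ scale a p +ₚ scale a q
  scale-distrib-+ₚ a p q = coeffwise λ k →
    trans (coeff-scale a (p +ₚ q) k) (trans (*-congˡ (coeff-+ₚ p q k)) (trans (distribˡ _ _ _)
      (sym (trans (coeff-+ₚ (scale a p) (scale a q) k) (+-cong (coeff-scale a p k) (coeff-scale a q k))))))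

  scale-+ : ∀ a b p → scale (a + b) p ≋ scale a p +ₚ scale b p
  scale-+ a b p = coeffwise λ k → trans (coeff-scale (a + b) p k) (trans (distribʳ _ _ _)
    (sym (trans (coeff-+ₚ (scale a p) (scale b p) k) (+-cong (coeff-scale a p k) (coeff-scale b p k)))))

  scale-scale : ∀ a b p → scale a (scale b p) ≋ scale (a * b) p
  scale-scale a b p = coeffwise λ k → trans (coeff-scale a (scale b p) k) (trans (*-congˡ (coeff-scale b p k))
    (trans (sym (*-assoc _ _ _)) (sym (coeff-scale (a * b) p k))))

  scale-0 : ∀ p → scale 0# p ≋ []
  scale-0 p = coeffwise λ k → trans (coeff-scale 0# p k) (zeroˡ _)

  scale-1 : ∀ p → scale 1# p ≋ p
  scale-1 p = coeffwise λ k → trans (coeff-scale 1# p k) (*-identityˡ _)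

  0∷-+ₚ : ∀ p q → 0# ∷ (p +ₚ q) ≋ (0# ∷ p) +ₚ (0# ∷ q)
  0∷-+ₚ p q = ∷-cong (sym (+-identityˡ 0#)) ≋.refl

  *ₚ-zeroʳ : ∀ p → p *ₚ [] ≋ []
  *ₚ-zeroʳ []      = ≋.refl
  *ₚ-zeroʳ (a ∷ p) = ≋.trans (∷-cong refl (*ₚ-zeroʳ p)) 0∷[]≈[]

  -- `_*ₚ_` recurses on its left factor. This is the mirror-image recursion on the right one, and
  -- commutativity follows from it by induction.
  *ₚ-∷ʳ : ∀ p b q → p *ₚ (b ∷ q) ≋ scale b p +ₚ (0# ∷ (p *ₚ q))
  *ₚ-∷ʳ []      b q = ≋.sym 0∷[]≈[]
  *ₚ-∷ʳ (a ∷ p) b q = ∷-cong (+-congʳ (*-comm a b)) (begin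
    scale a q +ₚ (p *ₚ (b ∷ q))                        ≈⟨ +ₚ-congˡ (*ₚ-∷ʳ p b q) ⟩
    scale a q +ₚ (scale b p +ₚ (0# ∷ (p *ₚ q)))         ≈⟨ +ₚ-assoc (scale a q) (scale b p) _ ⟨
    (scale a q +ₚ scale b p) +ₚ (0# ∷ (p *ₚ q))         ≈⟨ +ₚ-cong (+ₚ-comm (scale a q) (scale b p)) ≋.refl ⟩
    (scale b p +ₚ scale a q) +ₚ (0# ∷ (p *ₚ q))         ≈⟨ +ₚ-assoc (scale b p) (scale a q) _ ⟩
    scale b p +ₚ (scale a q +ₚ (0# ∷ (p *ₚ q)))         ∎)

  *ₚ-comm : ∀ p q → p *ₚ q ≋ q *ₚ p
  *ₚ-comm []      q = ≋.sym (*ₚ-zeroʳ q)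
  *ₚ-comm (a ∷ p) q = begin
    scale a q +ₚ (0# ∷ (p *ₚ q))   ≈⟨ +ₚ-congˡ (∷-cong refl (*ₚ-comm p q)) ⟩
    scale a q +ₚ (0# ∷ (q *ₚ p))   ≈⟨ *ₚ-∷ʳ q a p ⟨
    q *ₚ (a ∷ p)                   ∎

  *ₚ-congˡ : ∀ p {q q′} → q ≋ q′ → p *ₚ q ≋ p *ₚ q′
  *ₚ-congˡ []              q≈q′ = ≋.refl
  *ₚ-congˡ (a ∷ p) {q} {q′} q≈q′ =
    +ₚ-cong (scale-cong refl q≈q′) (∷-cong refl (*ₚ-congˡ p q≈q′))

  -- Equal polynomials may be lists of different lengths, so recursion on the left factor does not
  -- give congruence there; commutativity moves the change to the right.
  *ₚ-cong : ∀ {p p′ q q′} → p ≋ p′ → q ≋ q′ → p *ₚ q ≋ p′ *ₚ q′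
  *ₚ-cong {p} {p′} {q} {q′} p≈p′ q≈q′ = begin
    p *ₚ q    ≈⟨ *ₚ-congˡ p q≈q′ ⟩
    p *ₚ q′   ≈⟨ *ₚ-comm p q′ ⟩
    q′ *ₚ p   ≈⟨ *ₚ-congˡ q′ p≈p′ ⟩
    q′ *ₚ p′  ≈⟨ *ₚ-comm q′ p′ ⟩
    p′ *ₚ q′  ∎

  *ₚ-distribʳ : ∀ r p q → (p +ₚ q) *ₚ r ≋ (p *ₚ r) +ₚ (q *ₚ r)
  *ₚ-distribʳ r []      q       = ≋.refl
  *ₚ-distribʳ r (a ∷ p) []      = ≋.sym (+ₚ-identityʳ ((a ∷ p) *ₚ r))
  *ₚ-distribʳ r (a ∷ p) (b ∷ q) = begin
    scale (a + b) r +ₚ (0# ∷ ((p +ₚ q) *ₚ r))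
      ≈⟨ +ₚ-cong (scale-+ a b r) (≋.trans (∷-cong refl (*ₚ-distribʳ r p q)) (0∷-+ₚ (p *ₚ r) (q *ₚ r))) ⟩
    (scale a r +ₚ scale b r) +ₚ ((0# ∷ (p *ₚ r)) +ₚ (0# ∷ (q *ₚ r)))
      ≈⟨ +ₚ-interchange (scale a r) (scale b r) (0# ∷ (p *ₚ r)) (0# ∷ (q *ₚ r)) ⟩
    ((a ∷ p) *ₚ r) +ₚ ((b ∷ q) *ₚ r) ∎

  scale-*ₚ : ∀ a p q → scale a p *ₚ q ≋ scale a (p *ₚ q)
  scale-*ₚ a []      q = ≋.refl
  scale-*ₚ a (b ∷ p) q = begin
    scale (a * b) q +ₚ (0# ∷ (scale a p *ₚ q))
      ≈⟨ +ₚ-cong (≋.sym (scale-scale a b q)) (∷-cong (sym (zeroʳ a)) (scale-*ₚ a p q)) ⟩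
    scale a (scale b q) +ₚ scale a (0# ∷ (p *ₚ q))
      ≈⟨ scale-distrib-+ₚ a (scale b q) (0# ∷ (p *ₚ q)) ⟨
    scale a ((b ∷ p) *ₚ q) ∎

  0∷-*ₚ : ∀ p q → (0# ∷ p) *ₚ q ≋ 0# ∷ (p *ₚ q)
  0∷-*ₚ p q = +ₚ-cong (scale-0 q) ≋.refl

  *ₚ-assoc : ∀ p q r → (p *ₚ q) *ₚ r ≋ p *ₚ (q *ₚ r)
  *ₚ-assoc []      q r = ≋.refl
  *ₚ-assoc (a ∷ p) q r = begin
    (scale a q +ₚ (0# ∷ (p *ₚ q))) *ₚ r
      ≈⟨ *ₚ-distribʳ r (scale a q) (0# ∷ (p *ₚ q)) ⟩
    (scale a q *ₚ r) +ₚ ((0# ∷ (p *ₚ q)) *ₚ r)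
      ≈⟨ +ₚ-cong (scale-*ₚ a q r) (≋.trans (0∷-*ₚ (p *ₚ q) r) (∷-cong refl (*ₚ-assoc p q r))) ⟩
    scale a (q *ₚ r) +ₚ (0# ∷ (p *ₚ (q *ₚ r))) ∎

  constant-* : ∀ a p → constant a *ₚ p ≋ scale a p
  constant-* a p = ≋.trans (+ₚ-congˡ 0∷[]≈[]) (+ₚ-identityʳ (scale a p))

  *ₚ-identityˡ : ∀ p → constant 1# *ₚ p ≋ p
  *ₚ-identityˡ p = ≋.trans (constant-* 1# p) (scale-1 p)

  polyCommutativeRing : CommutativeRing c ℓ
  polyCommutativeRing = record
    { Carrier = Poly
    ; _≈_ = _≈ₚ_
    ; _+_ = _+ₚ_
    ; _*_ = _*ₚ_
    ; -_  = negₚ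
    ; 0#  = []
    ; 1#  = constant 1#
    ; isCommutativeRing = record
      { isRing = record
        { +-isAbelianGroup = record
          { isGroup = record
            { isMonoid = record
              { isSemigroup = record
                { isMagma = record
                  { isEquivalence = record
                    { refl  = λ _ → refl
                    ; sym   = λ p≈q k → sym (p≈q k)
                    ; trans = λ p≈q q≈r k → trans (p≈q k) (q≈r k)
                    }
                  ; ∙-cong = λ {p} {p′} {q} {q′} p≈p′ q≈q′ → at (+ₚ-cong {p} {p′} {q} {q′} (coeffwise p≈p′) (coeffwise q≈q′))
                  }
                ; assoc = λ p q r → at (+ₚ-assoc p q r)
                }
              ; identity = (λ p k → refl) , λ p → at (+ₚ-identityʳ p)
              }
            ; inverse = (λ p → at (neg-inverseˡ p)) , λ p → at (≋.trans (+ₚ-comm p (negₚ p)) (neg-inverseˡ p))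
            ; ⁻¹-cong = λ {p} {q} p≈q k → trans (coeff-neg p k) (trans (-‿cong (p≈q k)) (sym (coeff-neg q k)))
            }
          ; comm = λ p q → at (+ₚ-comm p q)
          }
        ; *-cong = λ {p} {p′} {q} {q′} p≈p′ q≈q′ → at (*ₚ-cong {p} {p′} {q} {q′} (coeffwise p≈p′) (coeffwise q≈q′))
        ; *-assoc = λ p q r → at (*ₚ-assoc p q r)
        ; *-identity = (λ p → at (*ₚ-identityˡ p)) , λ p → at (≋.trans (*ₚ-comm p (constant 1#)) (*ₚ-identityˡ p))
        ; distrib = (λ r p q → at (≋.trans (*ₚ-comm r (p +ₚ q)) (≋.trans (*ₚ-distribʳ r p q)
                       (+ₚ-cong (*ₚ-comm p r) (*ₚ-comm q r)))))
                  , λ r p q → at (*ₚ-distribʳ r p q)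
        }
      ; *-comm = λ p q → at (*ₚ-comm p q)
      }
    }

  -- Serves to recognise the coefficient list of `g` as a cubic expression evaluated at `X`.
  ∷-horner : ∀ a p → a ∷ p ≈ₚ constant a +ₚ (X *ₚ p)
  ∷-horner a p = at (≋.sym (begin
    constant a +ₚ (X *ₚ p)               ≈⟨ +ₚ-congˡ {constant a} (0∷-*ₚ (constant 1#) p) ⟩
    constant a +ₚ (0# ∷ (constant 1# *ₚ p))  ≈⟨ ∷-cong (+-identityʳ a) (*ₚ-identityˡ p) ⟩
    a ∷ p                                ∎))

-- Determinants: moving a column and expanding along a border.

-- Deleting column `s` of `C` moves the inserted column down by one place exactly when `s` lies
-- before `j`; `pinch s j` is that new place.
insertAt-pinch : ∀ {a} {A : Set a} {n} (C : Vector A (suc n)) (v : A) (j : Fin (suc (suc n))) s t →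
                 insertAt C j v (punchIn (punchIn j s) t) ≡ insertAt (removeAt C s) (pinch s j) v t
insertAt-pinch {n = n}     C v zero    s       zero    = ≡.refl
insertAt-pinch {n = n}     C v zero    s       (suc t) = ≡.refl
insertAt-pinch {n = n}     C v (suc j) zero    t       = ≡.refl
insertAt-pinch {n = suc n} C v (suc j) (suc s) zero    = ≡.refl
insertAt-pinch {n = suc n} C v (suc j) (suc s) (suc t) = insertAt-pinch (C ∘ suc) v j s t

insertAt-removeAt-updateAt : ∀ {a} {A : Set a} {n} (C : Vector A (suc n)) j v t →
                             insertAt (removeAt C j) j v t ≡ updateAt C j (const v) t
insertAt-removeAt-updateAt {n = n}     C zero    v zero    = ≡.refl
insertAt-removeAt-updateAt {n = n}     C zero    v (suc t) = ≡.refl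
insertAt-removeAt-updateAt {n = suc n} C (suc j) v zero    = ≡.refl
insertAt-removeAt-updateAt {n = suc n} C (suc j) v (suc t) = insertAt-removeAt-updateAt (C ∘ suc) j v t

module Determinant {ℓ₁ ℓ₂} (R : CommutativeRing ℓ₁ ℓ₂) where
  open CommutativeRing R hiding (zero)
  open IntegerCoefficients R
  open import Algebra.Properties.Semiring.Sum semiring
    using (sum; sum-cong-≋; sum-remove; ∑-distrib-+; *-distribˡ-sum)
  open import Algebra.Properties.Semiring.Exp semiring using (_^_)
  open import Algebra.Properties.Ring ring using (-1*x≈-x)
  open import Relation.Binary.Reasoning.Setoid setoid

  sign : ∀ {n} → Fin n → Carrier
  sign j = (- 1#) ^ toℕ j

  sum-neg : ∀ {n} (t : Vector Carrier n) → sum (λ j → - t j) ≈ - sum t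
  sum-neg t = trans (sum-cong-≋ (λ j → sym (-1*x≈-x (t j))))
    (trans (sym (*-distribˡ-sum (- 1#) t)) (-1*x≈-x (sum t)))

  det′ : ∀ {n} → Matrix Carrier n → Carrier
  det′ = det rawRing

  det-cong : ∀ {n} {M N : Matrix Carrier n} → (∀ r s → M r s ≈ N r s) → det′ M ≈ det′ N
  det-cong {zero}  M≈N = refl
  det-cong {suc n} M≈N = sum-cong-≋ λ j →
    *-congˡ {sign j} (*-cong (M≈N zero j) (det-cong (λ r s → M≈N (suc r) (punchIn j s))))

  fromColumns : ∀ {n} → Vector (Vector Carrier n) n → Matrix Carrier n
  fromColumns C r s = C s r

  -- If s < j, then `punchIn` keeps s and `pinch` lowers j; otherwise `punchIn` raises s and `pinch`
  -- keeps j. In both cases the sum of the two positions changes by one.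
  sign-pinch : ∀ {n} (j : Fin (suc (suc n))) (s : Fin (suc n)) →
               sign (punchIn j s) * sign (pinch s j) ≈ - (sign j * sign s)
  sign-pinch zero s =
    solve 1 (λ σ → (:- con (+ 1) :* σ) :* con (+ 1) := :- (con (+ 1) :* σ)) refl (sign s)
  sign-pinch (suc j) zero =
    solve 1 (λ σ → con (+ 1) :* σ := :- ((:- con (+ 1) :* σ) :* con (+ 1))) refl (sign j)
  sign-pinch {suc n} (suc j) (suc s) = begin
    (- 1# * a) * (- 1# * b)    ≈⟨ solve 2 (λ a b → (:- con (+ 1) :* a) :* (:- con (+ 1) :* b) := a :* b) refl a b ⟩
    a * b                      ≈⟨ sign-pinch j s ⟩
    - (sign j * sign s)        ≈⟨ solve 2 (λ a b → :- (a :* b) := :- ((:- con (+ 1) :* a) :* (:- con (+ 1) :* b))) refl (sign j) (sign s) ⟩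
    - ((- 1# * sign j) * (- 1# * sign s)) ∎
    where
    a = sign (punchIn j s)
    b = sign (pinch s j)

  sign-square : ∀ {n} (j : Fin n) → sign j * sign j ≈ 1#
  sign-square zero    = *-identityˡ 1#
  sign-square (suc j) =
    trans (solve 1 (λ σ → (:- con (+ 1) :* σ) :* (:- con (+ 1) :* σ) := σ :* σ) refl (sign j)) (sign-square j)

  updateAt-cong-≈ : ∀ {n} {f g : Vector Carrier n} {x y} → (∀ s → f s ≈ g s) → x ≈ y →
                    ∀ j s → updateAt f j (const x) s ≈ updateAt g j (const y) s
  updateAt-cong-≈ f≈g x≈y zero    zero    = x≈y
  updateAt-cong-≈ f≈g x≈y zero    (suc s) = f≈g (suc s)
  updateAt-cong-≈ f≈g x≈y (suc j) zero    = f≈g zero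
  updateAt-cong-≈ f≈g x≈y (suc j) (suc s) = updateAt-cong-≈ (f≈g ∘ suc) x≈y j s

  -- Induction on the size through the expansion along the first row. In the minor of any column `s`
  -- other than `v`, the column `v` stands at place `pinch s j`; moving it to the front by the
  -- induction hypothesis leaves `sign j * sign (suc s)` by `sign-pinch`, which is `sign j` times
  -- the sign that `s` has when `v` comes first.
  det-insertAt : ∀ {n} (C : Vector (Vector Carrier (suc n)) n) v j →
                 det′ (fromColumns (insertAt C j v)) ≈ sign j * det′ (fromColumns (insertAt C zero v))
  det-insertAt {zero}  C v zero = sym (*-identityˡ _)
  det-insertAt {suc n} C v j = begin
    sum terms
      ≈⟨ sum-remove {i = j} terms ⟩
    terms j + sum (λ s → terms (punchIn j s))
      ≈⟨ +-cong term-j (sum-cong-≋ term-s) ⟩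
    sign j * head₀ + sum (λ s → sign j * (sign (suc s) * (C s zero * det′ (fromColumns (minor s)))))
      ≈⟨ +-congˡ (*-distribˡ-sum (sign j) (λ s → sign (suc s) * (C s zero * det′ (fromColumns (minor s))))) ⟨
    sign j * head₀ + sign j * sum (λ s → sign (suc s) * (C s zero * det′ (fromColumns (minor s))))
      ≈⟨ distribˡ (sign j) _ _ ⟨
    sign j * (head₀ + sum (λ s → sign (suc s) * (C s zero * det′ (fromColumns (minor s)))))
      ≈⟨ *-congˡ (+-congˡ (sum-cong-≋ λ s → *-congˡ {sign (suc s)} (*-congˡ {C s zero} (det-cong (minor-zero s))))) ⟩
    sign j * det′ (fromColumns (insertAt C zero v)) ∎
    where
    drop : Vector Carrier (suc (suc n)) → Vector Carrier (suc n)
    drop = _∘ suc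
    terms : Vector Carrier (suc (suc n))
    terms t = sign t * (insertAt C j v t zero * det′ (λ r s → insertAt C j v (punchIn t s) (suc r)))
    head₀ : Carrier
    head₀ = sign {suc zero} zero * (v zero * det′ (λ r s → C s (suc r)))
    minor : Fin (suc n) → Vector (Vector Carrier (suc n)) (suc n)
    minor s = insertAt (λ t → drop (C (punchIn s t))) zero (drop v)
    minor-zero : ∀ s r t → minor s t r ≈ insertAt C zero v (punchIn (suc s) t) (suc r)
    minor-zero s r zero    = refl
    minor-zero s r (suc t) = refl
    term-j : terms j ≈ sign j * head₀
    term-j = *-congˡ (trans (*-cong (reflexive (cong (λ w → w zero) (insertAt-lookup C j v)))
      (det-cong λ r s → reflexive (cong (λ w → w (suc r)) (insertAt-punchIn C j v s)))) (sym (*-identityˡ _)))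
    drop-insertAt : ∀ {m} (D : Vector (Vector Carrier (suc (suc n))) m) k t r →
                    insertAt D k v t (suc r) ≡ insertAt (λ s → drop (D s)) k (drop v) t r
    drop-insertAt D zero zero r = ≡.refl
    drop-insertAt D zero (suc t) r = ≡.refl
    drop-insertAt {suc m} D (suc k) zero r = ≡.refl
    drop-insertAt {suc m} D (suc k) (suc t) r = drop-insertAt (D ∘ suc) k t r
    term-s : ∀ s → terms (punchIn j s) ≈ sign j * (sign (suc s) * (C s zero * det′ (fromColumns (minor s))))
    term-s s = begin
      sign (punchIn j s) * (insertAt C j v (punchIn j s) zero * det′ (λ r t → insertAt C j v (punchIn (punchIn j s) t) (suc r)))
        ≈⟨ *-congˡ (*-cong (reflexive (cong (λ w → w zero) (insertAt-punchIn C j v s)))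
             (det-cong λ r t → reflexive (≡.trans (cong (λ w → w (suc r)) (insertAt-pinch C v j s t))
                (drop-insertAt (removeAt C s) (pinch s j) t r)))) ⟩
      sign (punchIn j s) * (C s zero * det′ (fromColumns (insertAt (λ t → drop (C (punchIn s t))) (pinch s j) (drop v))))
        ≈⟨ *-congˡ (*-congˡ (det-insertAt (λ t → drop (C (punchIn s t))) (drop v) (pinch s j))) ⟩
      sign (punchIn j s) * (C s zero * (sign (pinch s j) * D))
        ≈⟨ solve 4 (λ a b c d → a :* (b :* (c :* d)) := (a :* c) :* (b :* d)) refl _ _ _ _ ⟩
      (sign (punchIn j s) * sign (pinch s j)) * (C s zero * D)
        ≈⟨ *-congʳ (sign-pinch j s) ⟩
      - (sign j * sign s) * (C s zero * D)
        ≈⟨ solve 3 (λ a b c → :- (a :* b) :* c := a :* ((:- con (+ 1) :* b) :* c)) refl _ _ _ ⟩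
      sign j * (sign (suc s) * (C s zero * D)) ∎
      where
      D = det′ (fromColumns (minor s))

  -- Expansion along the first row, with the first column moved to the place
  -- of the deleted one.
  det-bordered : ∀ {n} (M : Matrix Carrier (suc n)) →
    det′ M ≈ M zero zero * det′ (λ r s → M (suc r) (suc s))
           - sum (λ j → M zero (suc j) * det′ (λ r s → updateAt (M (suc r) ∘ suc) j (const (M (suc r) zero)) s))
  det-bordered {zero}  M = solve 1 (λ a → con (+ 1) :* (a :* con (+ 1)) :+ con (+ 0) := a :* con (+ 1) :- con (+ 0)) refl _
  det-bordered {suc n} M = +-cong (*-identityˡ _) (trans (sum-cong-≋ term) (sum-neg λ j → M zero (suc j) * det′ (λ r s → updateAt (M (suc r) ∘ suc) j (const (M (suc r) zero)) s)))
    where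
    col : Vector (Vector Carrier (suc n)) (suc (suc n))
    col s r = M (suc r) s
    updateAt-app : ∀ {m} (C : Vector (Vector Carrier (suc n)) m) v j s r →
                   updateAt C j (const v) s r ≡ updateAt (λ t → C t r) j (const (v r)) s
    updateAt-app C v zero    zero    r = ≡.refl
    updateAt-app C v zero    (suc s) r = ≡.refl
    updateAt-app C v (suc j) zero    r = ≡.refl
    updateAt-app C v (suc j) (suc s) r = updateAt-app (C ∘ suc) v j s r
    term : ∀ j → sign (suc j) * (M zero (suc j) * det′ (λ r s → M (suc r) (punchIn (suc j) s)))
               ≈ - (M zero (suc j) * det′ (λ r s → updateAt (M (suc r) ∘ suc) j (const (M (suc r) zero)) s))
    term j = begin
      sign (suc j) * (a * det′ (λ r s → M (suc r) (punchIn (suc j) s)))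
        ≈⟨ *-congˡ (*-congˡ (det-cong {M = λ r s → M (suc r) (punchIn (suc j) s)} first)) ⟩
      (- 1# * sign j) * (a * det′ (fromColumns (insertAt C′ zero v)))
        -- Of the two extra copies of `sign j`, one cancels the cofactor sign and the other carries
        -- `v` from the front to place `j`, by `det-insertAt` read backwards.
        ≈⟨ *-congˡ (*-congˡ (trans (sym (*-identityˡ _)) (*-congʳ (sym (sign-square j))))) ⟩
      (- 1# * sign j) * (a * (sign j * sign j * det′ (fromColumns (insertAt C′ zero v))))
        ≈⟨ solve 3 (λ σ a d → (:- con (+ 1) :* σ) :* (a :* (σ :* σ :* d)) := (σ :* σ) :* :- (a :* (σ :* d))) refl (sign j) a _ ⟩
      (sign j * sign j) * - (a * (sign j * det′ (fromColumns (insertAt C′ zero v))))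
        ≈⟨ trans (*-congʳ (sign-square j)) (*-identityˡ _) ⟩
      - (a * (sign j * det′ (fromColumns (insertAt C′ zero v))))
        ≈⟨ -‿cong (*-congˡ (sym (det-insertAt C′ v j))) ⟩
      - (a * det′ (fromColumns (insertAt C′ j v)))
        ≈⟨ -‿cong (*-congˡ (det-cong λ r s → reflexive (≡.trans
             (cong (λ w → w r) (insertAt-removeAt-updateAt (col ∘ suc) j v s)) (updateAt-app (col ∘ suc) v j s r)))) ⟩
      - (a * det′ (λ r s → updateAt (M (suc r) ∘ suc) j (const (M (suc r) zero)) s)) ∎
      where
      a = M zero (suc j)
      v = col zero
      C′ = removeAt (col ∘ suc) j
      first : ∀ r s → M (suc r) (punchIn (suc j) s) ≈ insertAt C′ zero v s r
      first r zero    = refl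
      first r (suc s) = refl

  -- Diagonal matrices perturbed by a matrix of rank two.

  product : ∀ {n} → Vector Carrier n → Carrier
  product {zero}  d = 1#
  product {suc n} d = d zero * product (d ∘ suc)

  -- Σₖ aₖ ∏_{i≠k} dᵢ
  product₁ : ∀ {n} → Vector Carrier n → Vector Carrier n → Carrier
  product₁ {zero}  d a = 0#
  product₁ {suc n} d a = d zero * product₁ (d ∘ suc) (a ∘ suc) + a zero * product (d ∘ suc)

  -- Σ_{k<l} Bₖₗ ∏_{i≠k,l} dᵢ
  product₂ : ∀ {n} → Vector Carrier n → Matrix Carrier n → Carrier
  product₂ {zero}  d B = 0#
  product₂ {suc n} d B =
    d zero * product₂ (d ∘ suc) (λ k l → B (suc k) (suc l)) + product₁ (d ∘ suc) (B zero ∘ suc)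

  product₁-cong : ∀ {n} (d : Vector Carrier n) {a b} → (∀ k → a k ≈ b k) → product₁ d a ≈ product₁ d b
  product₁-cong {zero}  d a≈b = refl
  product₁-cong {suc n} d a≈b =
    +-cong (*-congˡ (product₁-cong (d ∘ suc) (a≈b ∘ suc))) (*-congʳ (a≈b zero))

  -- Only pairs k < l are read, so the hypothesis may assume k ≢ l; this is what separates a
  -- replaced entry from a kept one in `sum-expansion`.
  product₂-cong : ∀ {n} (d : Vector Carrier n) {A B} → (∀ k l → k ≢ l → A k l ≈ B k l) →
                  product₂ d A ≈ product₂ d B
  product₂-cong {zero}  d A≈B = refl
  product₂-cong {suc n} d A≈B = +-cong
    (*-congˡ (product₂-cong (d ∘ suc) λ k l k≢l → A≈B (suc k) (suc l) (k≢l ∘ suc-injective)))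
    (product₁-cong (d ∘ suc) λ l → A≈B zero (suc l) λ ())

  product₁-+ : ∀ {n} (d a b : Vector Carrier n) →
               product₁ d (λ k → a k + b k) ≈ product₁ d a + product₁ d b
  product₁-+ {zero}  d a b = sym (+-identityˡ 0#)
  product₁-+ {suc n} d a b = trans (+-congʳ (*-congˡ (product₁-+ (d ∘ suc) (a ∘ suc) (b ∘ suc))))
    (solve 6 (λ d x y a b p → d :* (x :+ y) :+ (a :+ b) :* p := (d :* x :+ a :* p) :+ (d :* y :+ b :* p))
      refl _ _ _ _ _ _)

  product₁-*ˡ : ∀ {n} (d : Vector Carrier n) c a → product₁ d (λ k → c * a k) ≈ c * product₁ d a
  product₁-*ˡ {zero}  d c a = sym (zeroʳ c)
  product₁-*ˡ {suc n} d c a = trans (+-congʳ (*-congˡ (product₁-*ˡ (d ∘ suc) c (a ∘ suc))))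
    (solve 5 (λ d c x a p → d :* (c :* x) :+ (c :* a) :* p := c :* (d :* x :+ a :* p)) refl _ _ _ _ _)

  product₂-*ˡ : ∀ {n} (d : Vector Carrier n) c B → product₂ d (λ k l → c * B k l) ≈ c * product₂ d B
  product₂-*ˡ {zero}  d c B = sym (zeroʳ c)
  product₂-*ˡ {suc n} d c B = trans
    (+-cong (*-congˡ (product₂-*ˡ (d ∘ suc) c _)) (product₁-*ˡ (d ∘ suc) c _))
    (solve 4 (λ d c x y → d :* (c :* x) :+ c :* y := c :* (d :* x :+ y)) refl _ _ _ _)

  annihilate : ∀ {n} → Vector Carrier n → Fin n → Vector Carrier n
  annihilate d j = updateAt d j (const 0#)

  product-annihilate : ∀ {n} (d : Vector Carrier n) j → product (annihilate d j) ≈ 0#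
  product-annihilate d zero    = zeroˡ _
  product-annihilate d (suc j) = trans (*-congˡ (product-annihilate (d ∘ suc) j)) (zeroʳ _)

  -- With the j-th diagonal entry zero, only the summand that omits it survives, so the sum over j
  -- collects one summand for each index.
  sum-product₁-annihilate : ∀ {n} (c d : Vector Carrier n) (a : Matrix Carrier n) →
    sum (λ j → c j * product₁ (annihilate d j) (a j)) ≈ product₁ d (λ j → c j * a j j)
  sum-product₁-annihilate {zero}  c d a = refl
  sum-product₁-annihilate {suc n} c d a = begin
    c zero * (0# * product₁ d′ (a zero ∘ suc) + a zero zero * product d′) +
      sum (λ j → c (suc j) * (d zero * product₁ (annihilate d′ j) (a (suc j) ∘ suc) + a (suc j) zero * product (annihilate d′ j)))
        ≈⟨ +-cong
             (solve 4 (λ c x a p → c :* (con (+ 0) :* x :+ a :* p) := (c :* a) :* p) refl _ _ _ _)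
             (sum-cong-≋ λ j → trans
               (*-congˡ {c (suc j)} (+-congˡ {d zero * product₁ (annihilate d′ j) (a (suc j) ∘ suc)}
                 (trans (*-congˡ {a (suc j) zero} (product-annihilate d′ j)) (zeroʳ _))))
               (solve 3 (λ c d x → c :* (d :* x :+ con (+ 0)) := d :* (c :* x)) refl
                 (c (suc j)) (d zero) (product₁ (annihilate d′ j) (a (suc j) ∘ suc)))) ⟩
    (c zero * a zero zero) * product d′ + sum (λ j → d zero * (c (suc j) * product₁ (annihilate d′ j) (a (suc j) ∘ suc)))
        ≈⟨ +-congˡ (trans (sym (*-distribˡ-sum (d zero) (λ j → c (suc j) * product₁ (annihilate d′ j) (a (suc j) ∘ suc))))
             (*-congˡ (sum-product₁-annihilate (c ∘ suc) d′ (λ j → a (suc j) ∘ suc)))) ⟩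
    (c zero * a zero zero) * product d′ + d zero * product₁ d′ (λ j → c (suc j) * a (suc j) (suc j))
        ≈⟨ +-comm _ _ ⟩
    product₁ d (λ j → c j * a j j) ∎
    where
    d′ = d ∘ suc

  -- With the j-th diagonal entry zero, only the pairs containing j survive. Each pair is met twice,
  -- once from either member, whence the two terms.
  sum-product₂-annihilate : ∀ {n} (c d : Vector Carrier n) (B : Fin n → Matrix Carrier n) →
    sum (λ j → c j * product₂ (annihilate d j) (B j)) ≈ product₂ d (λ k l → c k * B k k l + c l * B l k l)
  sum-product₂-annihilate {zero}  c d B = refl
  sum-product₂-annihilate {suc n} c d B = begin
    c zero * (0# * product₂ d′ (B′ zero) + product₁ d′ (B zero zero ∘ suc)) +
      sum (λ j → c (suc j) * (d zero * product₂ (annihilate d′ j) (B′ (suc j)) + product₁ (annihilate d′ j) (B (suc j) zero ∘ suc)))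
        ≈⟨ +-cong
             (solve 3 (λ c x y → c :* (con (+ 0) :* x :+ y) := c :* y) refl _ _ _)
             (trans (sum-cong-≋ λ j → solve 4 (λ c d x y → c :* (d :* x :+ y) := d :* (c :* x) :+ c :* y) refl
                 (c (suc j)) (d zero) (product₂ (annihilate d′ j) (B′ (suc j))) (product₁ (annihilate d′ j) (B (suc j) zero ∘ suc)))
               (∑-distrib-+ (λ j → d zero * (c (suc j) * product₂ (annihilate d′ j) (B′ (suc j))))
                 (λ j → c (suc j) * product₁ (annihilate d′ j) (B (suc j) zero ∘ suc)))) ⟩
    c zero * product₁ d′ (B zero zero ∘ suc) +
      (sum (λ j → d zero * (c (suc j) * product₂ (annihilate d′ j) (B′ (suc j)))) +
       sum (λ j → c (suc j) * product₁ (annihilate d′ j) (B (suc j) zero ∘ suc)))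
        ≈⟨ +-cong (sym (product₁-*ˡ d′ (c zero) (B zero zero ∘ suc))) (+-cong
             (trans (sym (*-distribˡ-sum (d zero) (λ j → c (suc j) * product₂ (annihilate d′ j) (B′ (suc j)))))
               (*-congˡ (sum-product₂-annihilate (c ∘ suc) d′ (B′ ∘ suc))))
             (sum-product₁-annihilate (c ∘ suc) d′ (λ j → B (suc j) zero ∘ suc))) ⟩
    product₁ d′ (λ l → c zero * B zero zero (suc l)) +
      (d zero * product₂ d′ (λ k l → c (suc k) * B (suc k) (suc k) (suc l) + c (suc l) * B (suc l) (suc k) (suc l)) +
       product₁ d′ (λ l → c (suc l) * B (suc l) zero (suc l)))
        ≈⟨ solve 3 (λ a b c → a :+ (b :+ c) := b :+ (a :+ c)) refl _ _ _ ⟩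
    d zero * product₂ d′ (λ k l → c (suc k) * B (suc k) (suc k) (suc l) + c (suc l) * B (suc l) (suc k) (suc l)) +
      (product₁ d′ (λ l → c zero * B zero zero (suc l)) + product₁ d′ (λ l → c (suc l) * B (suc l) zero (suc l)))
        ≈⟨ +-congˡ (sym (product₁-+ d′ _ _)) ⟩
    product₂ d (λ k l → c k * B k k l + c l * B l k l) ∎
    where
    d′ = d ∘ suc
    B′ : Fin (suc n) → Matrix Carrier n
    B′ j k l = B j (suc k) (suc l)

  diagonal : ∀ {n} → Vector Carrier n → Matrix Carrier n
  diagonal d r s = if does (r ≟ s) then d s else 0#

  module RankTwo {n} (u₁ u₂ : Vector Carrier n) where

    perturbed : (d v₁ v₂ : Vector Carrier n) → Matrix Carrier n
    perturbed d v₁ v₂ r s = diagonal d r s + (u₁ r * v₁ s + u₂ r * v₂ s)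

    minors : (v₁ v₂ : Vector Carrier n) → Matrix Carrier n
    minors v₁ v₂ k l = (u₁ k * u₂ l - u₂ k * u₁ l) * (v₁ k * v₂ l - v₂ k * v₁ l)

    expansion : (d v₁ v₂ : Vector Carrier n) → Carrier
    expansion d v₁ v₂ =
      product d + product₁ d (λ k → u₁ k * v₁ k + u₂ k * v₂ k) + product₂ d (minors v₁ v₂)

    -- A new column in the span of `u₁` and `u₂` preserves the shape of the matrix: the diagonal
    -- loses one entry and only the row factors `v₁`, `v₂` change.
    perturbed-updateAt : ∀ d v₁ v₂ w₁ w₂ j r s →
      updateAt (perturbed d v₁ v₂ r) j (const (u₁ r * w₁ + u₂ r * w₂)) s
      ≈ perturbed (annihilate d j) (updateAt v₁ j (const w₁)) (updateAt v₂ j (const w₂)) r s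
    perturbed-updateAt d v₁ v₂ w₁ w₂ j r s with s ≟ j
    ... | yes ≡.refl
      rewrite updateAt-updates s {const (u₁ r * w₁ + u₂ r * w₂)} (perturbed d v₁ v₂ r)
            | updateAt-updates s {const 0#} d
            | updateAt-updates s {const w₁} v₁ | updateAt-updates s {const w₂} v₂
      with does (r ≟ s)
    ... | true  = sym (+-identityˡ _)
    ... | false = sym (+-identityˡ _)
    perturbed-updateAt d v₁ v₂ w₁ w₂ j r s | no s≢j
      rewrite updateAt-minimal s j {const (u₁ r * w₁ + u₂ r * w₂)} (perturbed d v₁ v₂ r) s≢j
            | updateAt-minimal s j {const 0#} d s≢j
            | updateAt-minimal s j {const w₁} v₁ s≢j | updateAt-minimal s j {const w₂} v₂ s≢j = refl

    sum-expansion : ∀ c d v₁ v₂ w₁ w₂ →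
      sum (λ j → c j * expansion (annihilate d j) (updateAt v₁ j (const w₁)) (updateAt v₂ j (const w₂)))
      ≈ product₁ d (λ k → c k * (u₁ k * w₁ + u₂ k * w₂))
        + product₂ d (λ k l → (u₁ k * u₂ l - u₂ k * u₁ l) *
            (c k * (w₁ * v₂ l - w₂ * v₁ l) - c l * (w₁ * v₂ k - w₂ * v₁ k)))
    sum-expansion c d v₁ v₂ w₁ w₂ = begin
      sum (λ j → c j * (product (annihilate d j) + Q j + W j))
        ≈⟨ sum-cong-≋ (λ j → trans (*-congˡ {c j} (+-congʳ {W j} (+-congʳ {Q j} (product-annihilate d j))))
             (solve 3 (λ c q w → c :* (con (+ 0) :+ q :+ w) := c :* q :+ c :* w) refl (c j) (Q j) (W j))) ⟩
      sum (λ j → c j * Q j + c j * W j)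
        ≈⟨ ∑-distrib-+ (λ j → c j * Q j) (λ j → c j * W j) ⟩
      sum (λ j → c j * Q j) + sum (λ j → c j * W j)
        ≈⟨ +-cong (sum-product₁-annihilate c d _) (sum-product₂-annihilate c d _) ⟩
      product₁ d (λ k → c k * (u₁ k * x₁ k k + u₂ k * x₂ k k))
        + product₂ d (λ k l → c k * minors (x₁ k) (x₂ k) k l + c l * minors (x₁ l) (x₂ l) k l)
        ≈⟨ +-cong (product₁-cong d λ k → *-congˡ (+-cong (*-congˡ (updated v₁ w₁ k)) (*-congˡ (updated v₂ w₂ k))))
             (product₂-cong d pair) ⟩
      _ ∎
      where
      x₁ x₂ : Matrix Carrier n
      x₁ j = updateAt v₁ j (const w₁)
      x₂ j = updateAt v₂ j (const w₂)
      Q W : Vector Carrier n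
      Q j = product₁ (annihilate d j) (λ k → u₁ k * x₁ j k + u₂ k * x₂ j k)
      W j = product₂ (annihilate d j) (minors (x₁ j) (x₂ j))
      updated : ∀ (v : Vector Carrier n) w k → updateAt v k (const w) k ≈ w
      updated v w k = reflexive (updateAt-updates k v)
      kept : ∀ (v : Vector Carrier n) w {k l} → k ≢ l → updateAt v l (const w) k ≈ v k
      kept v w {k} {l} k≢l = reflexive (updateAt-minimal k l v k≢l)
      minor-cong : ∀ {a b c d a′ b′ c′ d′} → a ≈ a′ → b ≈ b′ → c ≈ c′ → d ≈ d′ → a * b - c * d ≈ a′ * b′ - c′ * d′
      minor-cong p q r s = +-cong (*-cong p q) (-‿cong (*-cong r s))
      pair : ∀ k l → k ≢ l →
        c k * minors (x₁ k) (x₂ k) k l + c l * minors (x₁ l) (x₂ l) k l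
        ≈ (u₁ k * u₂ l - u₂ k * u₁ l) * (c k * (w₁ * v₂ l - w₂ * v₁ l) - c l * (w₁ * v₂ k - w₂ * v₁ k))
      pair k l k≢l = trans
        (+-cong
          (*-congˡ (*-congˡ (minor-cong (updated v₁ w₁ k) (kept v₂ w₂ (k≢l ∘ ≡.sym)) (updated v₂ w₂ k) (kept v₁ w₁ (k≢l ∘ ≡.sym)))))
          (*-congˡ (*-congˡ (minor-cong (kept v₁ w₁ k≢l) (updated v₂ w₂ l) (kept v₂ w₂ k≢l) (updated v₁ w₁ l)))))
        (solve 9 (λ ck cl e w₁ w₂ v₁k v₂k v₁l v₂l →
            ck :* (e :* (w₁ :* v₂l :- w₂ :* v₁l)) :+ cl :* (e :* (v₁k :* w₂ :- v₂k :* w₁))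
            := e :* (ck :* (w₁ :* v₂l :- w₂ :* v₁l) :- cl :* (w₁ :* v₂k :- w₂ :* v₁k)))
          refl (c k) (c l) (u₁ k * u₂ l - u₂ k * u₁ l) w₁ w₂ (v₁ k) (v₂ k) (v₁ l) (v₂ l))

  open RankTwo

  -- Induction on the size by `det-bordered`. Below the corner, column zero lies in the span of
  -- `u₁′` and `u₂′`, so by `perturbed-updateAt` every minor in the border sum is again of this
  -- form, with a diagonal entry annihilated. The induction hypothesis covers it because it asks
  -- nothing of the diagonal.
  det-perturbed : ∀ {n} (u₁ u₂ d v₁ v₂ : Vector Carrier n) →
                  det′ (perturbed u₁ u₂ d v₁ v₂) ≈ expansion u₁ u₂ d v₁ v₂
  det-perturbed {zero}  u₁ u₂ d v₁ v₂ = solve 0 (con (+ 1) := con (+ 1) :+ con (+ 0) :+ con (+ 0)) refl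
  det-perturbed {suc n} u₁ u₂ d v₁ v₂ = begin
    det′ (perturbed u₁ u₂ d v₁ v₂)
      ≈⟨ det-bordered (perturbed u₁ u₂ d v₁ v₂) ⟩
    (d zero + e) * det′ (perturbed u₁′ u₂′ d′ v₁′ v₂′) - sum (λ j → (0# + c j) * det′ (N j))
      ≈⟨ +-cong (*-congˡ (det-perturbed u₁′ u₂′ d′ v₁′ v₂′)) (-‿cong (trans
           (sum-cong-≋ λ j → *-cong (+-identityˡ (c j)) (trans (det-cong (N≈ j)) (det-perturbed u₁′ u₂′ _ _ _)))
           (sum-expansion u₁′ u₂′ c d′ v₁′ v₂′ (v₁ zero) (v₂ zero)))) ⟩
    (d zero + e) * (product d′ + product₁ d′ a + product₂ d′ B)
      - (product₁ d′ (λ k → c k * (u₁′ k * v₁ zero + u₂′ k * v₂ zero)) + product₂ d′ _)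
      ≈⟨ +-congˡ (-‿cong (+-congˡ (trans (product₂-cong d′ pair) (product₂-*ˡ d′ e B)))) ⟩
    (d zero + e) * (product d′ + product₁ d′ a + product₂ d′ B)
      - (product₁ d′ (λ k → c k * (u₁′ k * v₁ zero + u₂′ k * v₂ zero)) + e * product₂ d′ B)
      ≈⟨ solve 6 (λ d e p q w z → (d :+ e) :* (p :+ q :+ w) :- (z :+ e :* w)
                              := d :* p :+ (d :* q :+ e :* p) :+ (d :* w :+ (e :* q :+ :- con (+ 1) :* z))) refl
           (d zero) e (product d′) (product₁ d′ a) (product₂ d′ B) _ ⟩
    d zero * product d′ + (d zero * product₁ d′ a + e * product d′)
      + (d zero * product₂ d′ B + (e * product₁ d′ a + - 1# * product₁ d′ (λ k → c k * (u₁′ k * v₁ zero + u₂′ k * v₂ zero))))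
      ≈⟨ +-congˡ (+-congˡ (begin
           e * product₁ d′ a + - 1# * product₁ d′ (λ k → c k * (u₁′ k * v₁ zero + u₂′ k * v₂ zero))
             ≈⟨ +-cong (product₁-*ˡ d′ e a) (product₁-*ˡ d′ (- 1#) _) ⟨
           product₁ d′ (λ k → e * a k) + product₁ d′ (λ k → - 1# * (c k * (u₁′ k * v₁ zero + u₂′ k * v₂ zero)))
             ≈⟨ product₁-+ d′ _ _ ⟨
           product₁ d′ (λ k → e * a k + - 1# * (c k * (u₁′ k * v₁ zero + u₂′ k * v₂ zero)))
             ≈⟨ product₁-cong d′ single ⟩
           product₁ d′ (minors u₁ u₂ v₁ v₂ zero ∘ suc) ∎)) ⟩
    expansion u₁ u₂ d v₁ v₂ ∎
    where
    u₁′ = u₁ ∘ suc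
    u₂′ = u₂ ∘ suc
    v₁′ = v₁ ∘ suc
    v₂′ = v₂ ∘ suc
    d′ = d ∘ suc
    e = u₁ zero * v₁ zero + u₂ zero * v₂ zero
    a c : Vector Carrier n
    a k = u₁′ k * v₁′ k + u₂′ k * v₂′ k
    c j = u₁ zero * v₁′ j + u₂ zero * v₂′ j
    B : Matrix Carrier n
    B = minors u₁′ u₂′ v₁′ v₂′
    N : Fin n → Matrix Carrier n
    N j r s = updateAt (perturbed u₁ u₂ d v₁ v₂ (suc r) ∘ suc) j (const (0# + (u₁′ r * v₁ zero + u₂′ r * v₂ zero))) s
    N≈ : ∀ j r s → N j r s ≈ perturbed u₁′ u₂′ (annihilate d′ j) (updateAt v₁′ j (const (v₁ zero))) (updateAt v₂′ j (const (v₂ zero))) r s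
    N≈ j r s = trans (updateAt-cong-≈ (λ _ → refl) (+-identityˡ _) j s) (perturbed-updateAt u₁′ u₂′ d′ v₁′ v₂′ (v₁ zero) (v₂ zero) j r s)
    -- This is the vanishing of the 3 × 3 minor of U Vᵀ on the indices 0, k, l, and the reason why
    -- the expansion stops at pairs.
    pair : ∀ k l → k ≢ l → (u₁′ k * u₂′ l - u₂′ k * u₁′ l) *
            (c k * (v₁ zero * v₂′ l - v₂ zero * v₁′ l) - c l * (v₁ zero * v₂′ k - v₂ zero * v₁′ k)) ≈ e * B k l
    pair k l _ = solve 9 (λ f p₁ p₂ w₁ w₂ v₁k v₂k v₁l v₂l →
        f :* ((p₁ :* v₁k :+ p₂ :* v₂k) :* (w₁ :* v₂l :- w₂ :* v₁l) :- (p₁ :* v₁l :+ p₂ :* v₂l) :* (w₁ :* v₂k :- w₂ :* v₁k))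
        := (p₁ :* w₁ :+ p₂ :* w₂) :* (f :* (v₁k :* v₂l :- v₂k :* v₁l)))
      refl (u₁′ k * u₂′ l - u₂′ k * u₁′ l) (u₁ zero) (u₂ zero) (v₁ zero) (v₂ zero) (v₁′ k) (v₂′ k) (v₁′ l) (v₂′ l)
    -- The 2 × 2 minor of U Vᵀ on two indices is the product of the minors of U and of V
    -- (Cauchy-Binet).
    single : ∀ k → e * a k + - 1# * (c k * (u₁′ k * v₁ zero + u₂′ k * v₂ zero)) ≈ minors u₁ u₂ v₁ v₂ zero (suc k)
    single k = solve 8 (λ p₁ p₂ w₁ w₂ uk₁ uk₂ vk₁ vk₂ →
        (p₁ :* w₁ :+ p₂ :* w₂) :* (uk₁ :* vk₁ :+ uk₂ :* vk₂) :+ :- con (+ 1) :* ((p₁ :* vk₁ :+ p₂ :* vk₂) :* (uk₁ :* w₁ :+ uk₂ :* w₂))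
        := (p₁ :* uk₂ :- p₂ :* uk₁) :* (w₁ :* vk₂ :- w₂ :* vk₁))
      refl (u₁ zero) (u₂ zero) (v₁ zero) (v₂ zero) (u₁′ k) (u₂′ k) (v₁′ k) (v₂′ k)

-- Steiner distances in the star.

minimum-unique : ∀ {ℓ} {P : ℕ → Set ℓ} {d e} → Minimum P d → Minimum P e → d ≡ e
minimum-unique (pd , d≤) (pe , e≤) = ℕ.≤-antisym (d≤ _ pe) (e≤ _ pd)

-- The instance argument is named because conversion between two copies of
-- star (suc m) that differ in it unfolds the exhaustive search for the minimum.
module _ {m : ℕ} .{{nz : NonZero (suc m)}} where
  open Graph (starGraph m)


  private
    -- The spoke `i` is the only edge at the leaf `suc i`, so a walk from there to another vertex
    -- has to begin with it.
    leafStep : ∀ {F i v} → suc i ≢ v → Star (Adjacent F) (suc i) v → i ∈ F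
    leafStep i≢v ε = contradiction ≡.refl i≢v
    leafStep {F} {i} i≢v ((_ , e , e∈F , Vec.there i∈e , _) ◅ _) = subst (_∈ F) (≡.sym (x∈⁅y⁆⇒x≡y e i∈e)) e∈F

  -- Each leaf in `L` forces its own spoke, and these spokes together with the centre already form a
  -- connected subgraph. The hypothesis excludes a single leaf without the centre, whose distance is
  -- zero. Uniqueness of minima identifies the value without running the search that defines it.
  steinerDistance-star : ∀ s (L : Subset m) → (∀ i → i ∈ L → ∃ λ v → v ∈ s Vec.∷ L × suc i ≢ v) →
                         steinerDistance (star (suc m) {{nz}}) (s Vec.∷ L) ≡ ∣ L ∣
  steinerDistance-star s L another =
    minimum-unique (steinerDistance-minimum (star (suc m) {{nz}}) (s Vec.∷ L)) (subtree , least)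
    where
    subtree : SubtreeWithEdges (star (suc m) {{nz}}) (s Vec.∷ L) ∣ L ∣
    subtree = inside Vec.∷ L , L , (sub , ((zero , Vec.here) , λ u v u∈ v∈ → toCentre u u∈ ◅◅ fromCentre v v∈) , incl) , ≡.refl
      where
      sub : IsSubgraph (inside Vec.∷ L) L
      sub e e∈L Vec.here         = Vec.here
      sub e e∈L (Vec.there x∈e) = Vec.there (subst (_∈ L) (≡.sym (x∈⁅y⁆⇒x≡y e x∈e)) e∈L)
      toCentre : ∀ u → u ∈ inside Vec.∷ L → Star (Adjacent L) u zero
      toCentre zero    _               = ε
      toCentre (suc i) (Vec.there i∈L) = ((λ ()) , i , i∈L , Vec.there (x∈⁅x⁆ i) , Vec.here) ◅ ε
      fromCentre : ∀ u → u ∈ inside Vec.∷ L → Star (Adjacent L) zero u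
      fromCentre zero    _               = ε
      fromCentre (suc i) (Vec.there i∈L) = ((λ ()) , i , i∈L , Vec.here , Vec.there (x∈⁅x⁆ i)) ◅ ε
      incl : s Vec.∷ L ⊆ inside Vec.∷ L
      incl Vec.here         = Vec.here
      incl (Vec.there x∈L) = Vec.there x∈L
    least : ∀ k → SubtreeWithEdges (star (suc m) {{nz}}) (s Vec.∷ L) k → ∣ L ∣ ≤ k
    least k (U , F , (_ , (_ , walk) , S⊆U) , ∣F∣≡k) = subst (∣ L ∣ ≤_) ∣F∣≡k (p⊆q⇒∣p∣≤∣q∣ L⊆F)
      where
      L⊆F : L ⊆ F
      L⊆F {i} i∈L with v , v∈S , i≢v ← another i i∈L =
        leafStep i≢v (walk (suc i) v (S⊆U (Vec.there i∈L)) (S⊆U v∈S))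

coweight : ∀ {m} → Subset m → Fin m → ℕ
coweight t k = if Vec.lookup t k then 0 else 1

∣p∪⁅x⁆∣ : ∀ {m} (t : Subset m) k → ∣ t ∪ ⁅ k ⁆ ∣ ≡ coweight t k ℕ.+ ∣ t ∣
∣p∪⁅x⁆∣ (inside  Vec.∷ t) zero    = cong (suc ∘ ∣_∣) (∪-identityʳ t)
∣p∪⁅x⁆∣ (outside Vec.∷ t) zero    = cong (suc ∘ ∣_∣) (∪-identityʳ t)
∣p∪⁅x⁆∣ (inside  Vec.∷ t) (suc k) = ≡.trans (cong suc (∣p∪⁅x⁆∣ t k)) (≡.sym (ℕ.+-suc (coweight t k) ∣ t ∣))
∣p∪⁅x⁆∣ (outside Vec.∷ t) (suc k) = ∣p∪⁅x⁆∣ t k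

coweight-⁅⁆ : ∀ {m} (k l : Fin m) → coweight ⁅ k ⁆ l ≡ (if does (k ≟ l) then 0 else 1)
coweight-⁅⁆ zero    zero    = ≡.refl
coweight-⁅⁆ zero    (suc l) = cong (if_then 0 else 1) (lookup-replicate l outside)
coweight-⁅⁆ (suc k) zero    = ≡.refl
coweight-⁅⁆ (suc k) (suc l) = coweight-⁅⁆ k l

∣p∣≡0⇒⊥ : ∀ {m} (t : Subset m) → ∣ t ∣ ≡ 0 → t ≡ ⊥
∣p∣≡0⇒⊥ Vec.[]            _  = ≡.refl
∣p∣≡0⇒⊥ (outside Vec.∷ t) eq = cong (outside Vec.∷_) (∣p∣≡0⇒⊥ t eq)

∣p∣≡1⇒⁅x⁆ : ∀ {m} (t : Subset m) → ∣ t ∣ ≡ 1 → ∃ λ i → t ≡ ⁅ i ⁆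
∣p∣≡1⇒⁅x⁆ (inside  Vec.∷ t) eq = zero , cong (inside Vec.∷_) (∣p∣≡0⇒⊥ t (ℕ.suc-injective eq))
∣p∣≡1⇒⁅x⁆ (outside Vec.∷ t) eq with i , ≡.refl ← ∣p∣≡1⇒⁅x⁆ t eq = suc i , ≡.refl

0<∣p∣⇒Nonempty : ∀ {m} (t : Subset m) → 0 < ∣ t ∣ → Nonempty t
0<∣p∣⇒Nonempty (inside  Vec.∷ t) _  = zero , Vec.here
0<∣p∣⇒Nonempty (outside Vec.∷ t) 0< with j , j∈t ← 0<∣p∣⇒Nonempty t 0< = suc j , Vec.there j∈t

another-element : ∀ {m} (t : Subset m) i → 1 < ∣ t ∣ → ∃ λ j → j ∈ t × i ≢ j
another-element (inside  Vec.∷ t) zero    1< with j , j∈t ← 0<∣p∣⇒Nonempty t (ℕ.s<s⁻¹ 1<) =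
  suc j , Vec.there j∈t , λ ()
another-element (outside Vec.∷ t) zero    1< with j , j∈t ← 0<∣p∣⇒Nonempty t (ℕ.<-trans ℕ.z<s 1<) =
  suc j , Vec.there j∈t , λ ()
another-element (inside  Vec.∷ t) (suc i) 1< = zero , Vec.here , λ ()
another-element (outside Vec.∷ t) (suc i) 1< with j , j∈t , i≢j ← another-element t i 1< =
  suc j , Vec.there j∈t , i≢j ∘ suc-injective

-- The matrix 𝔇₂(star)[B,B] for f the set t of leaves, f itself being index zero.
distances : ∀ {m} → Subset m → Matrix ℕ (suc m)
distances t zero    zero    = 2
distances t zero    (suc l) = coweight t l ℕ.+ 2
distances t (suc k) zero    = coweight t k ℕ.+ 2
distances t (suc k) (suc l) = (if does (k ≟ l) then 0 else 1) ℕ.+ 1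

module _ {m} .{{nz : NonZero (suc m)}} (f : 𝒱₂ (suc m)) (t : Subset m) (f≡t : vertices f ≡ outside Vec.∷ t) (∣t∣≡2 : ∣ t ∣ ≡ 2) where

  private
    δ : Subset (suc m) → ℕ
    δ = steinerDistance (star (suc m) {{nz}})

    δ-centre : ∀ L → δ (inside Vec.∷ L) ≡ ∣ L ∣
    δ-centre L = steinerDistance-star {{nz}} inside L λ _ _ → zero , Vec.here , λ ()

    another : ∀ i → i ∈ t → ∃ λ v → v ∈ outside Vec.∷ t × suc i ≢ v
    another i _ with j , j∈t , i≢j ← another-element t i (subst (1 <_) (≡.sym ∣t∣≡2) (ℕ.s<s ℕ.z<s)) =
      suc j , Vec.there j∈t , i≢j ∘ suc-injective

  principal-star : ∀ i j → principal (𝔇₂ (star (suc m) {{nz}})) (f Vector.∷ spoke) i j ≡ distances t i j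
  principal-star zero zero = ≡.trans (cong (λ V → δ (V ∪ V)) f≡t)
    (≡.trans (cong (λ L → δ (outside Vec.∷ L)) (∪-idem t))
      (≡.trans (steinerDistance-star {{nz}} outside t another) ∣t∣≡2))
  principal-star zero (suc l) = ≡.trans (cong (λ V → δ (V ∪ vertices (spoke l))) f≡t)
    (≡.trans (δ-centre (t ∪ ⁅ l ⁆)) (≡.trans (∣p∪⁅x⁆∣ t l) (cong (coweight t l ℕ.+_) ∣t∣≡2)))
  principal-star (suc k) zero = ≡.trans (cong (λ V → δ (vertices (spoke k) ∪ V)) f≡t)
    (≡.trans (δ-centre (⁅ k ⁆ ∪ t)) (≡.trans (cong ∣_∣ (∪-comm ⁅ k ⁆ t))
      (≡.trans (∣p∪⁅x⁆∣ t k) (cong (coweight t k ℕ.+_) ∣t∣≡2))))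
  principal-star (suc k) (suc l) = ≡.trans (δ-centre (⁅ k ⁆ ∪ ⁅ l ⁆)) (≡.trans (∣p∪⁅x⁆∣ ⁅ k ⁆ l)
    (cong₂ ℕ._+_ (coweight-⁅⁆ k l) (∣⁅x⁆∣≡1 k)))

-- A pair containing the centre has exactly one leaf and so is a spoke. The cardinality proof is
-- irrelevant: it must be recomputed from decidable equality before use, but two pairs with the same
-- vertices are then equal by `refl`.
nonEdge⇒leaves : ∀ {m} (f : 𝒱₂ (suc m)) → (∀ e → spoke e ≢ f) →
                 ∃ λ t → vertices f ≡ outside Vec.∷ t × ∣ t ∣ ≡ 2
nonEdge⇒leaves (mk𝒱₂ (outside Vec.∷ t) ∣t∣≡2) f∉E = t , ≡.refl , recompute (∣ t ∣ ℕ.≟ 2) ∣t∣≡2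
nonEdge⇒leaves (mk𝒱₂ (inside Vec.∷ t) ∣f∣≡2) f∉E
  with i , ≡.refl ← ∣p∣≡1⇒⁅x⁆ t (ℕ.suc-injective (recompute (suc ∣ t ∣ ℕ.≟ 2) ∣f∣≡2)) =
  contradiction ≡.refl (f∉E i)

-- The determinant of x I - M over an arbitrary commutative ring.

module StarDeterminant {c ℓ} (R : CommutativeRing c ℓ) where
  open CommutativeRing R hiding (zero)
  open IntegerCoefficients R
  open Determinant R
  open RankTwo
  open import Algebra.Properties.Semiring.Sum semiring using (sum; sum-cong-≋)
  open import Algebra.Properties.Semiring.Exp semiring using (_^_)
  open import Algebra.Properties.Semiring.Mult semiring using (×-homo-+; ×1-homo-*) renaming (_×_ to _·_)
  open import Relation.Binary.Reasoning.Setoid setoid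

  fromℕ : ℕ → Carrier
  fromℕ k = k · 1#

  pairSum : ∀ {n} → Matrix Carrier n → Carrier
  pairSum {zero}  B = 0#
  pairSum {suc n} B = pairSum (λ k l → B (suc k) (suc l)) + sum (B zero ∘ suc)

  product-const : ∀ n y → product {n} (const y) ≈ y ^ n
  product-const zero    y = refl
  product-const (suc n) y = *-congˡ (product-const n y)

  product₁-const : ∀ {n} y (a : Vector Carrier n) → product₁ (const y) a ≈ sum a * y ^ (n ∸ 1)
  product₁-const {zero} y a = sym (zeroˡ _)
  product₁-const {suc zero} y a =
    solve 2 (λ y a → y :* con (+ 0) :+ a :* con (+ 1) := (a :+ con (+ 0)) :* con (+ 1)) refl y (a zero)
  product₁-const {suc (suc n)} y a = trans
    (+-cong (*-congˡ (product₁-const y (a ∘ suc))) (*-congˡ (product-const (suc n) y)))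
    (solve 4 (λ y s a p → y :* (s :* p) :+ a :* (y :* p) := (a :+ s) :* (y :* p)) refl y (sum (a ∘ suc)) (a zero) (y ^ n))

  -- Where `n ∸ 2` truncates there are no pairs, so `pairSum B` vanishes and the exponent is
  -- immaterial.
  product₂-const : ∀ {n} y (B : Matrix Carrier n) → product₂ (const y) B ≈ pairSum B * y ^ (n ∸ 2)
  product₂-const {zero} y B = sym (zeroˡ _)
  product₂-const {suc zero} y B =
    solve 1 (λ y → y :* con (+ 0) :+ con (+ 0) := (con (+ 0) :+ con (+ 0)) :* con (+ 1)) refl y
  product₂-const {suc (suc zero)} y B = trans
    (+-cong (*-congˡ (product₂-const {suc zero} y (λ k l → B (suc k) (suc l)))) (product₁-const y (B zero ∘ suc)))
    (solve 2 (λ y s → y :* ((con (+ 0) :+ con (+ 0)) :* con (+ 1)) :+ s :* con (+ 1) := ((con (+ 0) :+ con (+ 0)) :+ s) :* con (+ 1))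
      refl y (sum (B zero ∘ suc)))
  product₂-const {suc (suc (suc n))} y B = trans
    (+-cong (*-congˡ (product₂-const {suc (suc n)} y (λ k l → B (suc k) (suc l)))) (product₁-const y (B zero ∘ suc)))
    (solve 4 (λ y s a p → y :* (s :* p) :+ a :* (y :* p) := (s :+ a) :* (y :* p)) refl y _ _ (y ^ n))

  sum-affine : ∀ {n} α β (w : Vector Carrier n) → sum (λ k → α + β * w k) ≈ α * fromℕ n + β * sum w
  sum-affine {zero}  α β w = solve 2 (λ α β → con (+ 0) := α :* con (+ 0) :+ β :* con (+ 0)) refl α β
  sum-affine {suc n} α β w = trans (+-congˡ (sum-affine α β (w ∘ suc)))
    (solve 5 (λ α β w n s → (α :+ β :* w) :+ (α :* n :+ β :* s) := α :* (con (+ 1) :+ n) :+ β :* (w :+ s))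
      refl α β (w zero) (fromℕ n) (sum (w ∘ suc)))

  ω : ∀ {m} → Subset m → Vector Carrier m
  ω t k = fromℕ (coweight t k)

  -- `ω t` is the 0/1 indicator of the leaves outside `t`. Idempotence turns quadratic expressions
  -- in it into affine ones, whose sums involve only the numbers of leaves.
  ω-idem : ∀ {m} (t : Subset m) k → ω t k * ω t k ≈ ω t k
  ω-idem t k with Vec.lookup t k
  ... | true  = zeroˡ 0#
  ... | false = solve 0 ((con (+ 1) :+ con (+ 0)) :* (con (+ 1) :+ con (+ 0)) := con (+ 1) :+ con (+ 0)) refl

  ins outs : ∀ {m} → Subset m → Carrier
  ins  t = fromℕ ∣ t ∣
  outs t = fromℕ ∣ ∁ t ∣

  sum-ω : ∀ {m} (t : Subset m) → sum (ω t) ≈ outs t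
  sum-ω Vec.[]            = refl
  sum-ω (inside  Vec.∷ t) = trans (+-identityˡ _) (sum-ω t)
  sum-ω (outside Vec.∷ t) = +-cong (+-identityʳ 1#) (sum-ω t)

  ∣t∣+∣∁t∣ : ∀ {m} (t : Subset m) → ∣ t ∣ ℕ.+ ∣ ∁ t ∣ ≡ m
  ∣t∣+∣∁t∣ Vec.[]            = ≡.refl
  ∣t∣+∣∁t∣ (inside  Vec.∷ t) = cong suc (∣t∣+∣∁t∣ t)
  ∣t∣+∣∁t∣ (outside Vec.∷ t) = ≡.trans (ℕ.+-suc ∣ t ∣ ∣ ∁ t ∣) (cong suc (∣t∣+∣∁t∣ t))

  -- The indicator of the pairs that `t` separates. It arises from the 2 × 2 minors of the columns 1
  -- and `ω t`, and its sum over pairs counts one choice inside `t` and one outside.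
  ∇ : ∀ {m} → Subset m → Matrix Carrier m
  ∇ t k l = (ω t l - ω t k) * (ω t l - ω t k)

  sum-∇ : ∀ {m} (t : Subset m) → pairSum (∇ t) ≈ ins t * outs t
  sum-∇ Vec.[]            = sym (zeroˡ _)
  sum-∇ (inside  Vec.∷ t) = begin
    pairSum (∇ t) + sum (λ l → (ω t l - 0#) * (ω t l - 0#))
      ≈⟨ +-cong (sum-∇ t) (trans (sum-cong-≋ λ l → trans
           (solve 1 (λ w → (w :- con (+ 0)) :* (w :- con (+ 0)) := w :* w) refl (ω t l)) (ω-idem t l)) (sum-ω t)) ⟩
    ins t * outs t + outs t
      ≈⟨ solve 2 (λ a b → a :* b :+ b := (con (+ 1) :+ a) :* b) refl _ _ ⟩
    (1# + ins t) * outs t ∎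
  sum-∇ {suc m} (outside Vec.∷ t) = begin
    pairSum (∇ t) + sum (λ l → (ω t l - (1# + 0#)) * (ω t l - (1# + 0#)))
      ≈⟨ +-cong (sum-∇ t) (begin
           sum (λ l → (ω t l - (1# + 0#)) * (ω t l - (1# + 0#)))
             ≈⟨ sum-cong-≋ (λ l → trans
                  (solve 1 (λ w → (w :- (con (+ 1) :+ con (+ 0))) :* (w :- (con (+ 1) :+ con (+ 0)))
                    := con (+ 1) :+ (w :* w :+ :- con (+ 2) :* w)) refl (ω t l))
                  (+-congˡ (trans (+-congʳ (ω-idem t l))
                    (solve 1 (λ w → w :+ :- con (+ 2) :* w := :- con (+ 1) :* w) refl (ω t l))))) ⟩
           sum (λ l → 1# + - 1# * ω t l)
             ≈⟨ sum-affine 1# (- 1#) (ω t) ⟩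
           1# * fromℕ m + - 1# * sum (ω t)
             ≈⟨ +-cong (*-congˡ (reflexive (cong fromℕ (≡.sym (∣t∣+∣∁t∣ t))))) (*-congˡ (sum-ω t)) ⟩
           1# * fromℕ (∣ t ∣ ℕ.+ ∣ ∁ t ∣) + - 1# * outs t
             ≈⟨ +-congʳ (*-congˡ (×-homo-+ 1# ∣ t ∣ ∣ ∁ t ∣)) ⟩
           1# * (ins t + outs t) + - 1# * outs t
             ≈⟨ solve 2 (λ a b → con (+ 1) :* (a :+ b) :+ :- con (+ 1) :* b := a) refl _ _ ⟩
           ins t ∎) ⟩
    ins t * outs t + ins t
      ≈⟨ solve 2 (λ a b → a :* b :+ a := a :* (con (+ 1) :+ b)) refl _ _ ⟩
    ins t * (1# + outs t) ∎

  -- The value of `g (3 + o)` in Horner form, in a ring where x may be a scalar or the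
  -- indeterminate.
  cubic : ℕ → Carrier → Carrier
  cubic o x = - fromℕ (2 ℕ.+ o) + x * (- fromℕ (7 ℕ.* suc o) + x * (- fromℕ (2 ℕ.* (2 ℕ.+ o)) + x * 1#))

  cubic-expanded : ∀ o x → let m = fromℕ (2 ℕ.+ o) in
    cubic o x ≈ - m + x * (- (fromℕ 7 * fromℕ (suc o)) + x * (- (fromℕ 2 * m) + x * 1#))
  cubic-expanded o x = +-congˡ (*-congˡ (+-cong (-‿cong (×1-homo-* 7 (suc o)))
    (*-congˡ (+-congʳ (-‿cong (×1-homo-* 2 (2 ℕ.+ o)))))))

  charMatrix : ∀ {n} → Matrix ℕ n → Carrier → Matrix Carrier n
  charMatrix D x r s = (if does (r ≟ s) then x else 0#) + - fromℕ (D r s)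

  module _ {o} (t : Subset (2 ℕ.+ o)) (∣t∣≡2 : ∣ t ∣ ≡ 2) (x : Carrier) where

    private
      m = 2 ℕ.+ o
      y = x + 1#
      Y V₁ V₂ U₁ b : Vector Carrier m
      Y  = const y
      V₁ = const (- fromℕ 2)
      -- The block of spokes alone is y I - 2 J, a perturbation of rank one. The second column
      -- factor `ω t` is carried along with zero weight because the replacing column `b` is a
      -- combination of 1 and `ω t`.
      V₂ = const 0#
      U₁ = const 1#
      b l = - fromℕ (coweight t l ℕ.+ 2)
      A : Matrix Carrier m
      A r s = charMatrix (distances t) x (suc r) (suc s)

      A≈ : ∀ r s → A r s ≈ perturbed U₁ (ω t) Y V₁ V₂ r s
      A≈ r s with does (r ≟ s)
      ... | true  = solve 2 (λ x w → x :+ :- (con (+ 1) :+ con (+ 0)) := (x :+ con (+ 1)) :+ (con (+ 1) :* :- con (+ 2) :+ w :* con (+ 0))) refl x (ω t r)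
      ... | false = solve 1 (λ w → con (+ 0) :+ :- con (+ 2) := con (+ 0) :+ (con (+ 1) :* :- con (+ 2) :+ w :* con (+ 0))) refl (ω t r)

      b≈ : ∀ l → b l ≈ 1# * - fromℕ 2 + ω t l * - 1#
      b≈ l = trans (-‿cong (×-homo-+ 1# (coweight t l) 2))
        (solve 1 (λ w → :- (w :+ con (+ 2)) := con (+ 1) :* :- con (+ 2) :+ w :* :- con (+ 1)) refl (ω t l))

      ν : outs t ≈ fromℕ o
      ν = reflexive (cong fromℕ (≡.trans (∣∁p∣≡n∸∣p∣ t) (cong (2 ℕ.+ o ∸_) ∣t∣≡2)))

      sum-affine-ω : ∀ {a : Vector Carrier m} α β → (∀ k → a k ≈ α + β * ω t k) →
                     product₁ Y a ≈ (α * fromℕ m + β * fromℕ o) * (y * y ^ o)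
      sum-affine-ω {a} α β a≈ = trans (product₁-const y a) (*-congʳ (trans (sum-cong-≋ a≈)
        (trans (sum-affine α β (ω t)) (+-congˡ (*-congˡ (trans (sum-ω t) ν))))))

      pairSum-∇ : ∀ {B : Matrix Carrier m} e → (∀ k l → B k l ≈ e * ∇ t k l) →
                  product₂ Y B ≈ e * (fromℕ 2 * fromℕ o * y ^ o)
      pairSum-∇ {B} e B≈ = begin
        product₂ Y B                   ≈⟨ product₂-cong Y (λ k l _ → B≈ k l) ⟩
        product₂ Y (λ k l → e * ∇ t k l)  ≈⟨ product₂-*ˡ Y e (∇ t) ⟩
        e * product₂ Y (∇ t)           ≈⟨ *-congˡ (product₂-const y (∇ t)) ⟩
        e * (pairSum (∇ t) * y ^ o)    ≈⟨ *-congˡ (*-congʳ (trans (sum-∇ t) (*-cong (reflexive (cong fromℕ ∣t∣≡2)) ν))) ⟩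
        e * (fromℕ 2 * fromℕ o * y ^ o) ∎

      det-leaves : det′ A ≈ y * (y * y ^ o) + (- fromℕ 2 * fromℕ m + 0# * fromℕ o) * (y * y ^ o)
                            + 0# * (fromℕ 2 * fromℕ o * y ^ o)
      det-leaves = trans (det-cong A≈) (trans (det-perturbed U₁ (ω t) Y V₁ V₂) (+-cong
        (+-cong (product-const m y) (sum-affine-ω (- fromℕ 2) 0# λ k →
          solve 1 (λ w → con (+ 1) :* :- con (+ 2) :+ w :* con (+ 0) := :- con (+ 2) :+ con (+ 0) :* w) refl (ω t k)))
        (pairSum-∇ 0# λ k l →
          solve 2 (λ wk wl → (con (+ 1) :* wl :- wk :* con (+ 1)) :* (:- con (+ 2) :* con (+ 0) :- con (+ 0) :* :- con (+ 2))
             := con (+ 0) :* ((wl :- wk) :* (wl :- wk))) refl (ω t k) (ω t l))))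

      replaced : Fin m → Matrix Carrier m
      replaced j r s = updateAt (A r) j (const (0# + b r)) s

      sum-replaced : sum (λ j → (0# + b j) * det′ (replaced j))
        ≈ (fromℕ 4 * fromℕ m + fromℕ 5 * fromℕ o) * (y * y ^ o)
          + - fromℕ 2 * (fromℕ 2 * fromℕ o * y ^ o)
      sum-replaced = begin
        sum (λ j → (0# + b j) * det′ (replaced j))
          ≈⟨ sum-cong-≋ (λ j → *-cong (trans (+-identityˡ _) (b≈ j)) (trans
               (det-cong {M = replaced j} λ r s → trans (updateAt-cong-≈ (A≈ r) (trans (+-identityˡ _) (b≈ r)) j s)
                 (perturbed-updateAt U₁ (ω t) Y V₁ V₂ (- fromℕ 2) (- 1#) j r s))
               (det-perturbed U₁ (ω t) (annihilate Y j) (updateAt V₁ j (const (- fromℕ 2))) (updateAt V₂ j (const (- 1#)))))) ⟩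
        sum (λ j → c′ j * expansion U₁ (ω t) (annihilate Y j) (updateAt V₁ j (const (- fromℕ 2))) (updateAt V₂ j (const (- 1#))))
          ≈⟨ sum-expansion U₁ (ω t) c′ Y V₁ V₂ (- fromℕ 2) (- 1#) ⟩
        product₁ Y (λ k → c′ k * (1# * - fromℕ 2 + ω t k * - 1#)) + product₂ Y B′
          ≈⟨ +-cong
               (sum-affine-ω (fromℕ 4) (fromℕ 5) λ k → trans
                 (solve 1 (λ w → (con (+ 1) :* :- con (+ 2) :+ w :* :- con (+ 1)) :* (con (+ 1) :* :- con (+ 2) :+ w :* :- con (+ 1))
                   := con (+ 4) :+ (con (+ 4) :* w :+ w :* w)) refl (ω t k))
                 (+-congˡ (trans (+-congˡ (ω-idem t k)) (solve 1 (λ w → con (+ 4) :* w :+ w := con (+ 5) :* w) refl (ω t k)))))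
               -- Both brackets in the second factor equal -2, and c′ₖ - c′ₗ = ωₗ - ωₖ, so the pair
               -- contributes -2 times its entry in `∇ t`.
               (pairSum-∇ (- fromℕ 2) λ k l → solve 2 (λ wk wl →
                 (con (+ 1) :* wl :- wk :* con (+ 1)) :*
                   ((con (+ 1) :* :- con (+ 2) :+ wk :* :- con (+ 1)) :* (:- con (+ 2) :* con (+ 0) :- :- con (+ 1) :* :- con (+ 2))
                   :- (con (+ 1) :* :- con (+ 2) :+ wl :* :- con (+ 1)) :* (:- con (+ 2) :* con (+ 0) :- :- con (+ 1) :* :- con (+ 2)))
                 := :- con (+ 2) :* ((wl :- wk) :* (wl :- wk))) refl (ω t k) (ω t l)) ⟩
        _ ∎
        where
        c′ : Vector Carrier m
        c′ j = 1# * - fromℕ 2 + ω t j * - 1#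
        B′ : Matrix Carrier m
        B′ k l = (1# * ω t l - ω t k * 1#) *
          (c′ k * (- fromℕ 2 * 0# - - 1# * - fromℕ 2) - c′ l * (- fromℕ 2 * 0# - - 1# * - fromℕ 2))

    det-charMatrix : det′ (charMatrix (distances t) x) ≈ (x + 1#) ^ o * cubic o x
    det-charMatrix = begin
      det′ (charMatrix (distances t) x)
        ≈⟨ det-bordered (charMatrix (distances t) x) ⟩
      (x + - fromℕ 2) * det′ A - sum (λ j → (0# + b j) * det′ (replaced j))
        ≈⟨ +-cong (*-congˡ det-leaves) (-‿cong sum-replaced) ⟩
      _ ≈⟨ solve 3 (λ x p o → let y = x :+ con (+ 1) ; m = con (+ 1) :+ (con (+ 1) :+ o) in
             (x :+ :- con (+ 2)) :* (y :* (y :* p) :+ (:- con (+ 2) :* m :+ con (+ 0) :* o) :* (y :* p) :+ con (+ 0) :* (con (+ 2) :* o :* p))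
               :- ((con (+ 4) :* m :+ con (+ 5) :* o) :* (y :* p) :+ :- con (+ 2) :* (con (+ 2) :* o :* p))
             := p :* (:- m :+ x :* (:- (con (+ 7) :* (con (+ 1) :+ o)) :+ x :* (:- (con (+ 2) :* m) :+ x :* con (+ 1)))))
             refl x (y ^ o) (fromℕ o) ⟩
      y ^ o * (- fromℕ m + x * (- (fromℕ 7 * fromℕ (suc o)) + x * (- (fromℕ 2 * fromℕ m) + x * 1#)))
        ≈⟨ *-congˡ (cubic-expanded o x) ⟨
      y ^ o * cubic o x ∎

-- The characteristic polynomial.

module CharacteristicPolynomial {c ℓ} (R : CommutativeRing c ℓ) where
  open import Data.List.Base using ([]; _∷_)
  open CommutativeRing R hiding (zero)
  open Polynomial rawRing
  open PolynomialRing R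
  open import Algebra.Properties.Semiring.Mult semiring using () renaming (_×_ to _·_)

  private
    module P  = CommutativeRing polyCommutativeRing
    module Pₛ = StarDeterminant polyCommutativeRing

  open import Algebra.Properties.Semiring.Exp P.semiring using () renaming (_^_ to _^ₚ_)

  natural-constant : ∀ k → Pₛ.fromℕ k ≈ₚ constant (k · 1#)
  natural-constant zero    zero    = refl
  natural-constant zero    (suc i) = refl
  natural-constant (suc k) = P.+-cong {constant 1#} {constant 1#} {Pₛ.fromℕ k} {constant (k · 1#)} (λ _ → refl) (natural-constant k)

  horner-cubic : ∀ o → Pₛ.cubic o X ≈ₚ
    - ((2 ℕ.+ o) · 1#) ∷ - ((7 ℕ.* suc o) · 1#) ∷ - ((2 ℕ.* (2 ℕ.+ o)) · 1#) ∷ 1# ∷ []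
  horner-cubic o = step (2 ℕ.+ o) (step (7 ℕ.* suc o) (step (2 ℕ.* (2 ℕ.+ o)) {P.1#} λ _ → refl))
    where
    step : ∀ k {p q} → p ≈ₚ q → negₚ (Pₛ.fromℕ k) +ₚ (X *ₚ p) ≈ₚ - (k · 1#) ∷ q
    -- The polynomials are supplied explicitly because `_≈ₚ_` unfolds to a statement about
    -- coefficients, from which they cannot be inferred.
    step k {p} {q} p≈q = P.trans {negₚ (Pₛ.fromℕ k) +ₚ (X *ₚ p)} {constant a +ₚ (X *ₚ q)} {a ∷ q}
      (P.+-cong {negₚ (Pₛ.fromℕ k)} {constant a} {X *ₚ p} {X *ₚ q}
        (P.-‿cong {Pₛ.fromℕ k} {constant (k · 1#)} (natural-constant k))
        (P.*-cong {X} {X} {p} {q} (λ _ → refl) p≈q))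
      (P.sym {a ∷ q} {constant a +ₚ (X *ₚ q)} (∷-horner a q))
      where
      a : Carrier
      a = - (k · 1#)

  charPoly-star : ∀ {o} (t : Subset (2 ℕ.+ o)) → ∣ t ∣ ≡ 2 → (M : Matrix ℕ (3 ℕ.+ o)) →
    (∀ i j → M i j ≡ distances t i j) →
    charPoly (λ i j → M i j · 1#) ≈ₚ ((X +ₚ constant 1#) ^ₚ o) *ₚ
      (- ((2 ℕ.+ o) · 1#) ∷ - ((7 ℕ.* suc o) · 1#) ∷ - ((2 ℕ.* (2 ℕ.+ o)) · 1#) ∷ 1# ∷ [])
  charPoly-star {o} t ∣t∣≡2 M M≡ =
    P.trans {charPoly (λ i j → M i j · 1#)} {L *ₚ Pₛ.cubic o X} {L *ₚ G}
      (P.trans {charPoly (λ i j → M i j · 1#)} {det polyRing (Pₛ.charMatrix (distances t) X)} {L *ₚ Pₛ.cubic o X}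
        (Determinant.det-cong polyCommutativeRing {M = A} {N = Pₛ.charMatrix (distances t) X} entry) (Pₛ.det-charMatrix t ∣t∣≡2 X))
      (P.*-cong {L} {L} {Pₛ.cubic o X} {G} (λ _ → refl) (horner-cubic o))
    where
    L G : Poly
    L = (X +ₚ constant 1#) ^ₚ o
    G = - ((2 ℕ.+ o) · 1#) ∷ - ((7 ℕ.* suc o) · 1#) ∷ - ((2 ℕ.* (2 ℕ.+ o)) · 1#) ∷ 1# ∷ []
    A : Matrix Poly (3 ℕ.+ o)
    A i j = (if does (i ≟ j) then X else []) +ₚ constant (- (M i j · 1#))
    entry : ∀ i j → A i j ≈ₚ Pₛ.charMatrix (distances t) X i j
    entry i j rewrite M≡ i j =
      P.+-cong {D} {D} {constant (- (d · 1#))} {negₚ (Pₛ.fromℕ d)} (λ _ → refl)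
        (P.-‿cong {constant (d · 1#)} {Pₛ.fromℕ d} (P.sym {Pₛ.fromℕ d} {constant (d · 1#)} (natural-constant d)))
      where
      D = if does (i ≟ j) then X else []
      d = distances t i j

-- Eigenvalues over a Heyting field.

module Eigenvalues {c ℓ₁ ℓ₂} (K : HeytingField c ℓ₁ ℓ₂) where
  open HeytingField K using (_#_; #-cotrans; #-irrefl; #⇒invertible; tight; heytingCommutativeRing)

  R : CommutativeRing c ℓ₁
  R = HeytingCommutativeRing.commutativeRing heytingCommutativeRing

  open CommutativeRing R hiding (zero; rawRing)
  open IntegerCoefficients R
  open StarDeterminant R
  open Spectrum K
  open import Algebra.Properties.Semiring.Sum semiring using (sum; sum-cong-≋; ∑-distrib-+; *-distribˡ-sum; sum-replicate-zero)
  open import Algebra.Properties.Semiring.Mult semiring using (×-homo-+; ×1-homo-*)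
  open import Algebra.Apartness.Properties.HeytingCommutativeRing heytingCommutativeRing
    using (invertibleˡ⇒#; x-0≈x; x#0y#0→xy#0; #-congʳ; 1#0)
  open import Relation.Binary.Reasoning.Setoid setoid

  -- Apartness is tight, so equality with zero is proved by refuting apartness: a product of
  -- elements apart from zero is apart from zero.
  x*y≈0⇒x≈0 : ∀ {x y} → y # 0# → x * y ≈ 0# → x ≈ 0#
  x*y≈0⇒x≈0 y#0 xy≈0 = proj₁ (tight _ _) λ x#0 → #-irrefl xy≈0 (x#0y#0→xy#0 x#0 y#0)

  x*x≈0⇒x≈0 : ∀ {x} → x * x ≈ 0# → x ≈ 0#
  x*x≈0⇒x≈0 xx≈0 = proj₁ (tight _ _) λ x#0 → #-irrefl xx≈0 (x#0y#0→xy#0 x#0 x#0)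

  -- An inverse of x y, multiplied by x, is an inverse of y.
  x*y#0⇒y#0 : ∀ x {y} → x * y # 0# → y # 0#
  x*y#0⇒y#0 x {y} xy#0 with z , z*xy≈1 , _ ← #⇒invertible xy#0 = invertibleˡ⇒# (z * x , (begin
    (z * x) * (y - 0#)    ≈⟨ solve 3 (λ x y z → (z :* x) :* (y :- con (+ 0)) := z :* (x :* y :- con (+ 0))) refl x y z ⟩
    z * (x * y - 0#)      ≈⟨ z*xy≈1 ⟩
    1#                    ∎))

  -- Cotransitivity compares x + y and 0 with y; in the first case the invertible difference (x + y)
  -- - y is x.
  x+y#0⇒x#0⊎y#0 : ∀ {x y} → x + y # 0# → x # 0# ⊎ y # 0#
  x+y#0⇒x#0⊎y#0 {x} {y} x+y#0 with #-cotrans x+y#0 y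
  ... | inj₂ y#0 = inj₂ y#0
  ... | inj₁ x+y#y with z , z*x≈1 , _ ← #⇒invertible x+y#y = inj₁ (invertibleˡ⇒# (z , (begin
    z * (x - 0#)     ≈⟨ solve 3 (λ x y z → z :* (x :- con (+ 0)) := z :* (x :+ y :- y)) refl x y z ⟩
    z * (x + y - y)  ≈⟨ z*x≈1 ⟩
    1#               ∎)))

  -- The substitute for deciding whether `a` or `b` is zero: once a combination of them is a nonzero
  -- constant, one of them is apart from zero.
  comaximal : ∀ {k a} s {b} → k # 0# → k ≈ a + s * b → a # 0# ⊎ b # 0#
  comaximal s k#0 k≈ = map id (x*y#0⇒y#0 s) (x+y#0⇒x#0⊎y#0 (#-congʳ k≈ k#0))

  IsEigenvalue-cong : ∀ {n} {M N : Matrix Carrier n} {x} → (∀ i j → M i j ≈ N i j) →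
                      IsEigenvalue M x → IsEigenvalue N x
  IsEigenvalue-cong M≈N (v , v#0 , Mv≈xv) =
    v , v#0 , λ i → trans (sum-cong-≋ λ j → *-congʳ {v j} (sym (M≈N i j))) (Mv≈xv i)

  eval-g : ∀ o x → eval (g (3 ℕ.+ o)) x ≈ cubic o x
  eval-g o x = solve 4 (λ a b c x → a :+ x :* (b :+ x :* (c :+ x :* (con (+ 1) :+ x :* con (+ 0))))
      := a :+ x :* (b :+ x :* (c :+ x :* con (+ 1)))) refl
    (- natural (2 ℕ.+ o)) (- natural (7 ℕ.* suc o)) (- natural (2 ℕ.* (2 ℕ.+ o))) x

  -- The block of spokes is 2 J - I.
  sum-distances : ∀ {m} (k : Fin m) (w : Vector Carrier m) →
    sum (λ l → natural ((if does (k ≟ l) then 0 else 1) ℕ.+ 1) * w l) ≈ natural 2 * sum w - w k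
  sum-distances {suc m} zero w = trans (+-congˡ (sym (*-distribˡ-sum (natural 2) (w ∘ suc))))
    (solve 2 (λ w s → (con (+ 1) :+ con (+ 0)) :* w :+ con (+ 2) :* s := con (+ 2) :* (w :+ s) :- w) refl (w zero) (sum (w ∘ suc)))
  sum-distances {suc m} (suc k) w = trans (+-congˡ (sum-distances k (w ∘ suc)))
    (solve 3 (λ w s v → con (+ 2) :* w :+ (con (+ 2) :* s :- v) := con (+ 2) :* (w :+ s) :- v) refl (w zero) (sum (w ∘ suc)) (w (suc k)))

  SupportedOn : ∀ {m} → Subset m → Vector Carrier m → Set ℓ₁
  SupportedOn t w = ∀ k → ω t k * w k ≈ 0#

  point : ∀ {m} (t : Subset m) a → ∣ t ∣ ≡ 1 → ∃ λ w → SupportedOn t w × sum w ≈ a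
  point (outside Vec.∷ t) a ∣t∣≡1 with w , supported , sum≈a ← point t a ∣t∣≡1 =
    0# Vector.∷ w , (λ { zero → zeroʳ _ ; (suc k) → supported k }) , trans (+-identityˡ _) sum≈a
  point {suc m} (inside Vec.∷ t) a _ =
    a Vector.∷ const 0# , (λ { zero → zeroˡ a ; (suc k) → zeroʳ _ }) ,
    trans (+-congˡ (sum-replicate-zero m)) (+-identityʳ a)

  -- The vector eᵢ − eⱼ for t = {i , j}.
  difference : ∀ {m} (t : Subset m) → ∣ t ∣ ≡ 2 →
               ∃ λ w → SupportedOn t w × sum w ≈ 0# × ∃ λ k → w k # 0#
  difference (outside Vec.∷ t) ∣t∣≡2 with w , supported , sum≈0 , k , wk#0 ← difference t ∣t∣≡2 =
    0# Vector.∷ w , (λ { zero → zeroʳ _ ; (suc k) → supported k }) , trans (+-identityˡ _) sum≈0 , suc k , wk#0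
  difference (inside Vec.∷ t) ∣t∣≡2 with w , supported , sum≈-1 ← point t (- 1#) (ℕ.suc-injective ∣t∣≡2) =
    1# Vector.∷ w , (λ { zero → zeroˡ 1# ; (suc k) → supported k }) ,
    trans (+-congˡ sum≈-1) (-‿inverseʳ 1#) , zero , 1#0

  module _ {o} (t : Subset (2 ℕ.+ o)) (∣t∣≡2 : ∣ t ∣ ≡ 2) where

    private
      m = 2 ℕ.+ o

    D : Matrix Carrier (suc m)
    D = toMatrix (distances t)

    Tsum : Vector Carrier m → Carrier
    Tsum w = sum (λ k → ω t k * w k)

    row-f : ∀ v → sum (λ j → D zero j * v j) ≈ natural 2 * v zero + (Tsum (v ∘ suc) + natural 2 * sum (v ∘ suc))
    row-f v = +-congˡ (begin
      sum (λ l → natural (coweight t l ℕ.+ 2) * w l)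
        ≈⟨ sum-cong-≋ (λ l → trans (*-congʳ (×-homo-+ 1# (coweight t l) 2)) (distribʳ (w l) (ω t l) (natural 2))) ⟩
      sum (λ l → ω t l * w l + natural 2 * w l)
        ≈⟨ ∑-distrib-+ (λ l → ω t l * w l) (λ l → natural 2 * w l) ⟩
      Tsum w + sum (λ l → natural 2 * w l)
        ≈⟨ +-congˡ (*-distribˡ-sum (natural 2) w) ⟨
      Tsum w + natural 2 * sum w ∎)
      where
      w = v ∘ suc

    row-leaf : ∀ v k → sum (λ j → D (suc k) j * v j)
                       ≈ (ω t k + natural 2) * v zero + (natural 2 * sum (v ∘ suc) - v (suc k))
    row-leaf v k = +-cong (*-congʳ (×-homo-+ 1# (coweight t k) 2)) (sum-distances k (v ∘ suc))

    sum-ω≈o : sum (ω t) ≈ natural o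
    sum-ω≈o = trans (sum-ω t) (reflexive (cong natural (≡.trans (∣∁p∣≡n∸∣p∣ t) (cong (2 ℕ.+ o ∸_) ∣t∣≡2))))

    sum-affine′ : ∀ {a : Vector Carrier m} α β → (∀ k → a k ≈ α + β * ω t k) → sum a ≈ α * natural m + β * natural o
    sum-affine′ α β a≈ = trans (sum-cong-≋ a≈) (trans (sum-affine α β (ω t)) (+-congˡ (*-congˡ sum-ω≈o)))

    module _ (x : Carrier) where

      private
        y = x + 1#
        N = natural o

      module _ (v : Vector Carrier (suc m)) (Dv≈xv : ∀ i → sum (λ j → D i j * v j) ≈ x * v i) where

        private
          a = v zero
          w = v ∘ suc
          S = sum w
          T = Tsum w

          leaf : ∀ k → y * w k ≈ (natural 2 * a + natural 2 * S) + a * ω t k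
          leaf k = begin
            y * w k      ≈⟨ solve 2 (λ x w → (x :+ con (+ 1)) :* w := x :* w :+ w) refl x (w k) ⟩
            x * w k + w k ≈⟨ +-congʳ (trans (sym (Dv≈xv (suc k))) (row-leaf v k)) ⟩
            (ω t k + natural 2) * a + (natural 2 * S - w k) + w k
                         ≈⟨ solve 4 (λ u a s w → (u :+ con (+ 2)) :* a :+ (con (+ 2) :* s :- w) :+ w
                                := (con (+ 2) :* a :+ con (+ 2) :* s) :+ a :* u) refl (ω t k) a S (w k) ⟩
            (natural 2 * a + natural 2 * S) + a * ω t k ∎

          -- The residuals of a 3 × 3 linear system in `a`, `S`, `T`: row f, the sum of the leaf
          -- equations, and their sum over the leaves outside `t`. The determinant of the system is
          -- g(x).
          ρ₀ ρ₁ ρ₂ : Carrier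
          ρ₀ = x * a - (natural 2 * a + (T + natural 2 * S))
          ρ₁ = y * S - ((natural 2 * a + natural 2 * S) * natural m + a * N)
          ρ₂ = y * T - (0# * natural m + (natural 3 * a + natural 2 * S) * N)

          ≈⇒-≈0 : ∀ {p q} → p ≈ q → p - q ≈ 0#
          ≈⇒-≈0 p≈q = trans (+-congʳ p≈q) (-‿inverseʳ _)

          ρ₀≈0 : ρ₀ ≈ 0#
          ρ₀≈0 = ≈⇒-≈0 (trans (sym (Dv≈xv zero)) (row-f v))

          ρ₁≈0 : ρ₁ ≈ 0#
          ρ₁≈0 = ≈⇒-≈0 (trans (*-distribˡ-sum y w) (sum-affine′ _ a leaf))

          ρ₂≈0 : ρ₂ ≈ 0#
          ρ₂≈0 = ≈⇒-≈0 (trans (*-distribˡ-sum y (λ k → ω t k * w k)) (sum-affine′ 0# _ λ k → begin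
            y * (ω t k * w k)
              ≈⟨ solve 3 (λ y u w → y :* (u :* w) := u :* (y :* w)) refl y (ω t k) (w k) ⟩
            ω t k * (y * w k)
              ≈⟨ *-congˡ (leaf k) ⟩
            ω t k * ((natural 2 * a + natural 2 * S) + a * ω t k)
              ≈⟨ solve 3 (λ u a s → u :* ((con (+ 2) :* a :+ con (+ 2) :* s) :+ a :* u)
                   := (con (+ 2) :* a :+ con (+ 2) :* s) :* u :+ a :* (u :* u)) refl (ω t k) a S ⟩
            (natural 2 * a + natural 2 * S) * ω t k + a * (ω t k * ω t k)
              ≈⟨ +-congˡ (*-congˡ (ω-idem t k)) ⟩
            (natural 2 * a + natural 2 * S) * ω t k + a * ω t k
              ≈⟨ solve 3 (λ u a s → (con (+ 2) :* a :+ con (+ 2) :* s) :* u :+ a :* u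
                   := con (+ 0) :+ (con (+ 3) :* a :+ con (+ 2) :* s) :* u) refl (ω t k) a S ⟩
            0# + (natural 3 * a + natural 2 * S) * ω t k ∎))

          kill : ∀ {p q r} → (p * ρ₀ + q * ρ₁) + r * ρ₂ ≈ 0#
          kill {p} {q} {r} = trans (+-cong (+-cong (*-congˡ ρ₀≈0) (*-congˡ ρ₁≈0)) (*-congˡ ρ₂≈0))
            (solve 3 (λ p q r → (p :* con (+ 0) :+ q :* con (+ 0)) :+ r :* con (+ 0) := con (+ 0)) refl p q r)

        -- Cramer's rule without division: the multipliers of the residuals are the cofactors of the
        -- column of `a` in the 3 × 3 system.
        cubic*f≈0 : cubic o x * a ≈ 0#
        cubic*f≈0 = begin
          cubic o x * a ≈⟨ *-congʳ (cubic-expanded o x) ⟩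
          _ ≈⟨ solve 5 (λ x n a s t → let y = x :+ con (+ 1) ; m = con (+ 1) :+ (con (+ 1) :+ n)
                                          r₀ = x :* a :- (con (+ 2) :* a :+ (t :+ con (+ 2) :* s))
                                          r₁ = y :* s :- ((con (+ 2) :* a :+ con (+ 2) :* s) :* m :+ a :* n)
                                          r₂ = y :* t :- (con (+ 0) :* m :+ (con (+ 3) :* a :+ con (+ 2) :* s) :* n)
                                          l = y :- con (+ 2) :* m in
               (:- m :+ x :* (:- (con (+ 7) :* (con (+ 1) :+ n)) :+ x :* (:- (con (+ 2) :* m) :+ x :* con (+ 1)))) :* a
               := (l :* y :* r₀ :+ (con (+ 2) :* l :+ con (+ 2) :* n :+ con (+ 4) :* m) :* r₁) :+ l :* r₂) refl x N a S T ⟩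
          _ ≈⟨ kill ⟩
          0# ∎

        -- As for `a`, with the cofactors of the column of `S`.
        cubic*S≈0 : cubic o x * S ≈ 0#
        cubic*S≈0 = begin
          cubic o x * S ≈⟨ *-congʳ (cubic-expanded o x) ⟩
          _ ≈⟨ solve 5 (λ x n a s t → let y = x :+ con (+ 1) ; m = con (+ 1) :+ (con (+ 1) :+ n)
                                          r₀ = x :* a :- (con (+ 2) :* a :+ (t :+ con (+ 2) :* s))
                                          r₁ = y :* s :- ((con (+ 2) :* a :+ con (+ 2) :* s) :* m :+ a :* n)
                                          r₂ = y :* t :- (con (+ 0) :* m :+ (con (+ 3) :* a :+ con (+ 2) :* s) :* n)
                                          l = con (+ 2) :* m :+ n in
               (:- m :+ x :* (:- (con (+ 7) :* (con (+ 1) :+ n)) :+ x :* (:- (con (+ 2) :* m) :+ x :* con (+ 1)))) :* s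
               := (l :* y :* r₀ :+ (con (+ 2) :* l :+ (y :* x :- con (+ 2) :* y :- con (+ 5) :* n :- con (+ 4) :* m)) :* r₁) :+ l :* r₂) refl x N a S T ⟩
          _ ≈⟨ kill ⟩
          0# ∎

        cubic*y*leaf≈0 : ∀ k → (cubic o x * y) * w k ≈ 0#
        cubic*y*leaf≈0 k = begin
          (G * y) * w k   ≈⟨ *-assoc G y (w k) ⟩
          G * (y * w k)   ≈⟨ *-congˡ (leaf k) ⟩
          G * ((natural 2 * a + natural 2 * S) + a * ω t k)
            ≈⟨ solve 4 (λ g a s u → g :* ((con (+ 2) :* a :+ con (+ 2) :* s) :+ a :* u)
                 := (con (+ 2) :+ u) :* (g :* a) :+ con (+ 2) :* (g :* s)) refl G a S (ω t k) ⟩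
          (natural 2 + ω t k) * (G * a) + natural 2 * (G * S)
            ≈⟨ +-cong (*-congˡ cubic*f≈0) (*-congˡ cubic*S≈0) ⟩
          (natural 2 + ω t k) * 0# + natural 2 * 0#
            ≈⟨ solve 1 (λ u → (con (+ 2) :+ u) :* con (+ 0) :+ con (+ 2) :* con (+ 0) := con (+ 0)) refl (ω t k) ⟩
          0# ∎
          where
          G = cubic o x

      eigenvalue⇒ : IsEigenvalue D x → cubic o x ≈ 0# ⊎ cubic o x * y ≈ 0#
      eigenvalue⇒ (v , (zero  , v#0) , Dv≈xv) = inj₁ (x*y≈0⇒x≈0 v#0 (cubic*f≈0 v Dv≈xv))
      eigenvalue⇒ (v , (suc k , v#0) , Dv≈xv) = inj₂ (x*y≈0⇒x≈0 v#0 (cubic*y*leaf≈0 v Dv≈xv k))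

      eigenvector : (a : Carrier) (w : Vector Carrier m) →
        natural 2 * a + (Tsum w + natural 2 * sum w) ≈ x * a →
        (∀ k → (ω t k + natural 2) * a + (natural 2 * sum w - w k) ≈ x * w k) →
        a # 0# ⊎ ∃ (λ k → w k # 0#) → IsEigenvalue D x
      eigenvector a w row₀ rows nonzero = v , index nonzero , λ where
          zero    → trans (row-f v) row₀
          (suc k) → trans (row-leaf v k) (rows k)
        where
        v : Vector Carrier (suc m)
        v = a Vector.∷ w
        index : a # 0# ⊎ ∃ (λ k → w k # 0#) → ∃ λ i → v i # 0#
        index (inj₁ a#0)        = zero , a#0
        index (inj₂ (k , wk#0)) = suc k , wk#0

      -1-eigenvalue : y ≈ 0# → IsEigenvalue D x
      -1-eigenvalue y≈0 with w , supported , sum≈0 , nonzero ← difference t ∣t∣≡2 =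
        eigenvector 0# w
          (trans (+-congˡ (+-cong (trans (sum-cong-≋ supported) (sum-replicate-zero m)) (*-congˡ sum≈0)))
            (solve 1 (λ x → con (+ 2) :* con (+ 0) :+ (con (+ 0) :+ con (+ 2) :* con (+ 0)) := x :* con (+ 0)) refl x))
          (λ k → begin
            (ω t k + natural 2) * 0# + (natural 2 * sum w - w k)
              ≈⟨ +-congˡ (+-congʳ (*-congˡ sum≈0)) ⟩
            (ω t k + natural 2) * 0# + (natural 2 * 0# - w k)
              ≈⟨ solve 3 (λ u x w → (u :+ con (+ 2)) :* con (+ 0) :+ (con (+ 2) :* con (+ 0) :- w)
                   := x :* w :- (x :+ con (+ 1)) :* w) refl (ω t k) x (w k) ⟩
            x * w k - y * w k
              ≈⟨ +-congˡ (-‿cong (trans (*-congʳ y≈0) (zeroˡ (w k)))) ⟩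
            x * w k - 0#
              ≈⟨ x-0≈x (x * w k) ⟩
            x * w k ∎)
          (inj₂ nonzero)

      -- The characteristic polynomial (x - 2)(x - 3) - 8 of the quotient on {f} and `t` alone. It
      -- is also the last coordinate of the cross product that gives the eigenvector for n > 3.
      q : Carrier
      q = x * x - natural 5 * x - natural 2

      -- The eigenvector of the quotient matrix on the classes {f}, t and its
      -- complement: the cross product of the first two rows, scaled so that no
      -- division is needed when the complement of t is empty.
      quotient-eigenvalue : ∀ {r} z → natural 8 * r # 0# → N * z ≈ r * q →
        y * z ≈ r * (natural 3 * x - 1#) + y * (natural 2 * r * y) → IsEigenvalue D x
      quotient-eigenvalue {r} z 8r#0 Nz≈ yz≈ = eigenvector a w row₀ rows nonzero
        where
        a b : Carrier
        a = r * (natural 3 * x - 1#)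
        b = natural 2 * r * y
        w : Vector Carrier m
        w k = b + (z - b) * ω t k
        sum-w : natural 2 * sum w ≈ natural 4 * b + natural 2 * (r * q)
        sum-w = begin
          natural 2 * sum w                                ≈⟨ *-congˡ (sum-affine′ b (z - b) λ _ → refl) ⟩
          natural 2 * (b * natural m + (z - b) * N)
            ≈⟨ solve 3 (λ b z n → con (+ 2) :* (b :* (con (+ 1) :+ (con (+ 1) :+ n)) :+ (z :- b) :* n)
                 := con (+ 4) :* b :+ con (+ 2) :* (n :* z)) refl b z N ⟩
          natural 4 * b + natural 2 * (N * z)              ≈⟨ +-congˡ (*-congˡ Nz≈) ⟩
          natural 4 * b + natural 2 * (r * q) ∎
        Tsum-w : Tsum w ≈ r * q
        Tsum-w = begin
          Tsum w                       ≈⟨ sum-affine′ 0# z (λ k → begin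
            ω t k * (b + (z - b) * ω t k)
              ≈⟨ solve 3 (λ u b z → u :* (b :+ (z :- b) :* u) := b :* u :+ (z :- b) :* (u :* u)) refl (ω t k) b z ⟩
            b * ω t k + (z - b) * (ω t k * ω t k)
              ≈⟨ +-congˡ (*-congˡ (ω-idem t k)) ⟩
            b * ω t k + (z - b) * ω t k
              ≈⟨ solve 3 (λ u b z → b :* u :+ (z :- b) :* u := con (+ 0) :+ z :* u) refl (ω t k) b z ⟩
            0# + z * ω t k ∎) ⟩
          0# * natural m + z * N       ≈⟨ solve 3 (λ m z n → con (+ 0) :* m :+ z :* n := n :* z) refl (natural m) z N ⟩
          N * z                        ≈⟨ Nz≈ ⟩
          r * q ∎
        row₀ : natural 2 * a + (Tsum w + natural 2 * sum w) ≈ x * a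
        row₀ = trans (+-congˡ (+-cong Tsum-w sum-w))
          (solve 2 (λ r x → let y = x :+ con (+ 1)
                                q = x :* x :- con (+ 5) :* x :- con (+ 2)
                                a = r :* (con (+ 3) :* x :- con (+ 1))
                                b = con (+ 2) :* r :* y in
            con (+ 2) :* a :+ (r :* q :+ (con (+ 4) :* b :+ con (+ 2) :* (r :* q))) := x :* a) refl r x)
        rows : ∀ k → (ω t k + natural 2) * a + (natural 2 * sum w - w k) ≈ x * w k
        rows k = begin
          (ω t k + natural 2) * a + (natural 2 * sum w - w k)
            ≈⟨ +-congˡ (+-congʳ sum-w) ⟩
          (ω t k + natural 2) * a + ((natural 4 * b + natural 2 * (r * q)) - w k)
            ≈⟨ solve 4 (λ u a s w → (u :+ con (+ 2)) :* a :+ (s :- w) := u :* a :+ ((con (+ 2) :* a :+ s) :- w))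
                 refl (ω t k) a (natural 4 * b + natural 2 * (r * q)) (w k) ⟩
          ω t k * a + ((natural 2 * a + (natural 4 * b + natural 2 * (r * q))) - w k)
            ≈⟨ +-congˡ (+-congʳ y*b) ⟩
          ω t k * a + (y * b - w k)
            ≈⟨ solve 5 (λ u a b x z → let y = x :+ con (+ 1) ; w = b :+ (z :- b) :* u in
                 u :* a :+ (y :* b :- w) := x :* w :+ u :* ((a :+ y :* b) :- y :* z)) refl (ω t k) a b x z ⟩
          x * w k + ω t k * ((a + y * b) - y * z)
            -- A leaf row outside `t` differs from one inside by `a`, so it demands y z = a + y b,
            -- which is `yz≈`.
            ≈⟨ +-congˡ (*-congˡ (trans (+-congˡ (-‿cong yz≈)) (-‿inverseʳ _))) ⟩
          x * w k + ω t k * 0#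
            ≈⟨ trans (+-congˡ (zeroʳ _)) (+-identityʳ _) ⟩
          x * w k ∎
          where
          y*b : natural 2 * a + (natural 4 * b + natural 2 * (r * q)) ≈ y * b
          y*b = solve 2 (λ r x → let y = x :+ con (+ 1)
                                     q = x :* x :- con (+ 5) :* x :- con (+ 2)
                                     a = r :* (con (+ 3) :* x :- con (+ 1))
                                     b = con (+ 2) :* r :* y in
            con (+ 2) :* a :+ (con (+ 4) :* b :+ con (+ 2) :* (r :* q)) := y :* b) refl r x
        nonzero : a # 0# ⊎ ∃ λ k → w k # 0#
        -- The combination -2 a + 3 b eliminates x and leaves 8 r; hence `a` or `b` is apart from
        -- zero, and `b` is the entry at every leaf of `t`.
        nonzero = map (x*y#0⇒y#0 (- natural 2)) witness (comaximal (natural 3) 8r#0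
          (solve 2 (λ r x → con (+ 8) :* r := :- con (+ 2) :* (r :* (con (+ 3) :* x :- con (+ 1))) :+ con (+ 3) :* (con (+ 2) :* r :* (x :+ con (+ 1)))) refl r x))
          where
          witness : b # 0# → ∃ λ k → w k # 0#
          witness b#0 with k , k∈t ← 0<∣p∣⇒Nonempty t (subst (0 <_) (≡.sym ∣t∣≡2) ℕ.z<s) =
            k , #-congʳ (sym (begin
              b + (z - b) * ω t k  ≡⟨ cong (λ s → b + (z - b) * natural (if s then 0 else 1)) ([]=⇒lookup k∈t) ⟩
              b + (z - b) * 0#     ≈⟨ trans (+-congˡ (zeroʳ _)) (+-identityʳ b) ⟩
              b                    ∎)) b#0

  module _ (char0 : CharacteristicZero) where

    private
      +1≈0⇒≈-1 : ∀ {x} → x + 1# ≈ 0# → x ≈ - 1#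
      +1≈0⇒≈-1 {x} y≈0 = trans (solve 1 (λ x → x := (x :+ con (+ 1)) :- con (+ 1)) refl x)
        (trans (+-congʳ y≈0) (+-identityˡ _))

      -- q(−1) = 4 and, for o > 0, g(−1) = 4o: this is what decides, without
      -- decidable equality, which factor of a vanishing product vanishes.
      q-split : ∀ {o} (t : Subset (2 ℕ.+ o)) ∣t∣≡2 x → q t ∣t∣≡2 x # 0# ⊎ x + 1# # 0#
      q-split t ∣t∣≡2 x = comaximal (natural 6 - x) (char0 3)
        (solve 1 (λ x → con (+ 4) := (x :* x :- con (+ 5) :* x :- con (+ 2)) :+ (con (+ 6) :- x) :* (x :+ con (+ 1))) refl x)

      cubic-split : ∀ o x → cubic (suc o) x # 0# ⊎ x + 1# # 0#
      cubic-split o x = comaximal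
        -- Minus the quotient of g(x) by x + 1, so that adding this multiple of x + 1 to g(x) leaves
        -- the remainder g(-1). The factor `natural 6 - x` in `q-split` arises from `q` in the same
        -- way.
        (- (x * x - (natural 2 * natural (3 ℕ.+ o) + 1#) * x + (natural 8 - natural 5 * natural (3 ℕ.+ o))))
        (char0 (o ℕ.+ 3 ℕ.* suc o)) (begin
          natural (4 ℕ.* suc o)            ≈⟨ ×1-homo-* 4 (suc o) ⟩
          natural 4 * natural (suc o)
            ≈⟨ solve 2 (λ x n → let m = con (+ 1) :+ (con (+ 1) :+ n) in
                 con (+ 4) :* n := (:- m :+ x :* (:- (con (+ 7) :* (con (+ 1) :+ n)) :+ x :* (:- (con (+ 2) :* m) :+ x :* con (+ 1))))
                   :+ :- (x :* x :- (con (+ 2) :* m :+ con (+ 1)) :* x :+ (con (+ 8) :- con (+ 5) :* m)) :* (x :+ con (+ 1)))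
                 refl x (natural (suc o)) ⟩
          _ ≈⟨ +-congʳ (cubic-expanded (suc o) x) ⟨
          _ ∎)

      cubic-0 : ∀ (t : Subset 2) ∣t∣≡2 x → cubic 0 x ≈ (x + 1#) * q t ∣t∣≡2 x
      cubic-0 t ∣t∣≡2 x = trans (cubic-expanded 0 x)
        (solve 1 (λ x → let m = con (+ 2) in
          :- m :+ x :* (:- (con (+ 7) :* (con (+ 1) :+ con (+ 0))) :+ x :* (:- (con (+ 2) :* m) :+ x :* con (+ 1)))
          := (x :+ con (+ 1)) :* (x :* x :- con (+ 5) :* x :- con (+ 2))) refl x)

    eigenvalues-star : ∀ {o} (t : Subset (2 ℕ.+ o)) (∣t∣≡2 : ∣ t ∣ ≡ 2) x →
      IsEigenvalue (D t ∣t∣≡2) x ⇔ ((0 < o × x ≈ - 1#) ⊎ cubic o x ≈ 0#)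
    eigenvalues-star {o} t ∣t∣≡2 x = mk⇔ (λ e → to t ∣t∣≡2 (eigenvalue⇒ t ∣t∣≡2 x e)) (from t ∣t∣≡2)
      where
      to : ∀ {o} (t : Subset (2 ℕ.+ o)) → ∣ t ∣ ≡ 2 → cubic o x ≈ 0# ⊎ cubic o x * (x + 1#) ≈ 0# →
           (0 < o × x ≈ - 1#) ⊎ cubic o x ≈ 0#
      to t ∣t∣≡2 (inj₁ g≈0) = inj₂ g≈0
      -- For n = 3 the factor x + 1 must be absorbed into g = (x + 1) q. If x + 1 is apart from
      -- zero, it cancels; if q is, then (x + 1)² = 0, and a Heyting field has no nonzero
      -- nilpotents.
      to {zero} t ∣t∣≡2 (inj₂ gy≈0) = inj₂ ([ q#0⇒ , (λ y#0 → x*y≈0⇒x≈0 y#0 gy≈0) ]′ (q-split t ∣t∣≡2 x))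
        where
        q#0⇒ : q t ∣t∣≡2 x # 0# → cubic 0 x ≈ 0#
        q#0⇒ q#0 = trans (cubic-0 t ∣t∣≡2 x) (trans (*-congʳ (x*x≈0⇒x≈0 (x*y≈0⇒x≈0 q#0 (begin
          (x + 1#) * (x + 1#) * q t ∣t∣≡2 x   ≈⟨ solve 2 (λ y q → y :* y :* q := y :* q :* y) refl (x + 1#) (q t ∣t∣≡2 x) ⟩
          (x + 1#) * q t ∣t∣≡2 x * (x + 1#)   ≈⟨ *-congʳ (cubic-0 t ∣t∣≡2 x) ⟨
          cubic 0 x * (x + 1#)                ≈⟨ gy≈0 ⟩
          0#                                  ∎)))) (zeroˡ _))
      to {suc o} t ∣t∣≡2 (inj₂ gy≈0) =
        map (λ g#0 → ℕ.z<s , +1≈0⇒≈-1 (x*y≈0⇒x≈0 g#0 (trans (*-comm _ _) gy≈0)))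
            (λ y#0 → x*y≈0⇒x≈0 y#0 gy≈0) (cubic-split o x)

      from : ∀ {o} (t : Subset (2 ℕ.+ o)) ∣t∣≡2 → (0 < o × x ≈ - 1#) ⊎ cubic o x ≈ 0# → IsEigenvalue (D t ∣t∣≡2) x
      from t ∣t∣≡2 (inj₁ (_ , x≈-1)) = -1-eigenvalue t ∣t∣≡2 x (trans (+-congʳ x≈-1) (-‿inverseˡ 1#))
      from {zero} t ∣t∣≡2 (inj₂ g≈0) = [ q#0⇒ , y#0⇒ ]′ (q-split t ∣t∣≡2 x)
        where
        yq≈0 : (x + 1#) * q t ∣t∣≡2 x ≈ 0#
        yq≈0 = trans (sym (cubic-0 t ∣t∣≡2 x)) g≈0
        q#0⇒ : q t ∣t∣≡2 x # 0# → IsEigenvalue (D t ∣t∣≡2) x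
        q#0⇒ q#0 = -1-eigenvalue t ∣t∣≡2 x (x*y≈0⇒x≈0 q#0 yq≈0)
        y#0⇒ : x + 1# # 0# → IsEigenvalue (D t ∣t∣≡2) x
        -- The complement of `t` is empty, so z is the entry of no leaf and N z = r q reduces to q =
        -- 0. The value 3 x - 1 is chosen to solve the last equation: (x + 1)(3 x - 1) exceeds its
        -- right-hand side by q.
        y#0⇒ y#0 = quotient-eigenvalue t ∣t∣≡2 x {1#} (natural 3 * x - 1#)
          (#-congʳ (sym (*-identityʳ _)) (char0 7))
          (trans (zeroˡ _) (sym (trans (*-identityˡ _) q≈0)))
          (begin
            (x + 1#) * (natural 3 * x - 1#)
              ≈⟨ solve 1 (λ x → (x :+ con (+ 1)) :* (con (+ 3) :* x :- con (+ 1))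
                   := con (+ 1) :* (con (+ 3) :* x :- con (+ 1)) :+ (x :+ con (+ 1)) :* (con (+ 2) :* con (+ 1) :* (x :+ con (+ 1)))
                      :+ (x :* x :- con (+ 5) :* x :- con (+ 2))) refl x ⟩
            1# * (natural 3 * x - 1#) + (x + 1#) * (natural 2 * 1# * (x + 1#)) + q t ∣t∣≡2 x
              ≈⟨ trans (+-congˡ q≈0) (+-identityʳ _) ⟩
            1# * (natural 3 * x - 1#) + (x + 1#) * (natural 2 * 1# * (x + 1#)) ∎)
          where
          q≈0 : q t ∣t∣≡2 x ≈ 0#
          q≈0 = x*y≈0⇒x≈0 y#0 (trans (*-comm _ _) yq≈0)
      from {suc o} t ∣t∣≡2 (inj₂ g≈0) = quotient-eigenvalue t ∣t∣≡2 x {n} (q t ∣t∣≡2 x)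
          (x#0y#0→xy#0 (char0 7) (char0 o)) refl
          (begin
            (x + 1#) * q t ∣t∣≡2 x
              -- The cross product satisfies the first two rows identically; in the third, the
              -- defect is the determinant g(x).
              ≈⟨ solve 2 (λ x n → let m = con (+ 1) :+ (con (+ 1) :+ n) in
                   (x :+ con (+ 1)) :* (x :* x :- con (+ 5) :* x :- con (+ 2))
                   := (n :* (con (+ 3) :* x :- con (+ 1)) :+ (x :+ con (+ 1)) :* (con (+ 2) :* n :* (x :+ con (+ 1))))
                      :+ (:- m :+ x :* (:- (con (+ 7) :* (con (+ 1) :+ n)) :+ x :* (:- (con (+ 2) :* m) :+ x :* con (+ 1))))) refl x n ⟩
            _ ≈⟨ +-congˡ (trans (sym (cubic-expanded (suc o) x)) g≈0) ⟩
            _ ≈⟨ +-identityʳ _ ⟩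
            n * (natural 3 * x - 1#) + (x + 1#) * (natural 2 * n * (x + 1#)) ∎)
        where
        n = natural (suc o)

-- The spectrum of the principal submatrix.

module _ {c ℓ₁ ℓ₂} (K : HeytingField c ℓ₁ ℓ₂) where
  open Eigenvalues K
  open Spectrum K
  open HeytingField K using (_≈_; -_; 0#; 1#; sym; trans; reflexive)

  -- The matrix is an abstract `N` known only through its entries, so nothing here depends on how
  -- Steiner distances are computed. Two members of `t` require at least two leaves, which makes n
  -- at least 3 and the truncated subtractions exact.
  spectrum-distances : CharacteristicZero → ∀ {m} (t : Subset m) → ∣ t ∣ ≡ 2 →
    (N : Matrix ℕ (suc m)) → (∀ i j → N i j ≡ distances t i j) →
    (charPoly (toMatrix N) ≈ₚ ((X +ₚ constant 1#) ^ₚ (suc m ∸ 3)) *ₚ g (suc m))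
    × (∀ x → IsEigenvalue (toMatrix N) x ⇔ ((3 < suc m × x ≈ - 1#) ⊎ eval (g (suc m)) x ≈ 0#))
  spectrum-distances char0 {zero} Vec.[] ()
  spectrum-distances char0 {suc zero} t ∣t∣≡2 = contradiction (subst (ℕ._≤ 1) ∣t∣≡2 (∣p∣≤n t)) ℕ.1+n≰n
  spectrum-distances char0 {suc (suc o)} t ∣t∣≡2 N N≡ =
      CharacteristicPolynomial.charPoly-star R t ∣t∣≡2 N N≡
    , λ x → mk⇔ (to x) (from x)
    where
    N≈D : ∀ i j → toMatrix N i j ≈ D t ∣t∣≡2 i j
    N≈D i j = reflexive (cong natural (N≡ i j))
    to : ∀ x → IsEigenvalue (toMatrix N) x → (3 < 3 ℕ.+ o × x ≈ - 1#) ⊎ eval (g (3 ℕ.+ o)) x ≈ 0#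
    to x e = map (λ (0<o , x≈-1) → ℕ.+-monoʳ-< 3 0<o , x≈-1) (trans (eval-g o x))
      (Equivalence.to (eigenvalues-star char0 t ∣t∣≡2 x) (IsEigenvalue-cong N≈D e))
    from : ∀ x → (3 < 3 ℕ.+ o × x ≈ - 1#) ⊎ eval (g (3 ℕ.+ o)) x ≈ 0# → IsEigenvalue (toMatrix N) x
    from x e = IsEigenvalue-cong (λ i j → sym (N≈D i j)) (Equivalence.from (eigenvalues-star char0 t ∣t∣≡2 x)
      (map (λ (3<n , x≈-1) → ℕ.+-cancelˡ-< 3 0 o 3<n , x≈-1) (trans (sym (eval-g o x))) e))

open import Data.Vec.Functional using (_∷_)

theorem5p3 :
  ∀ {c ℓ₁ ℓ₂} (K : HeytingField c ℓ₁ ℓ₂) →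
  let open HeytingField K
      open Spectrum K
  in CharacteristicZero →
  ∀ (n : ℕ) .{{_ : NonZero n}} →
  let E = Tree.edge (star n) in
  (f : 𝒱₂ n) → (∀ e → E e ≢ f) →
  let B = f ∷ E
      M = toMatrix (principal (𝔇₂ (star n)) B)
  in (charPoly M ≈ₚ ((X +ₚ constant 1#) ^ₚ (n ∸ 3)) *ₚ g n)
     × (∀ x → IsEigenvalue M x ⇔ ((3 < n × x ≈ - 1#) ⊎ eval (g n) x ≈ 0#))
theorem5p3 K char0 (suc m) {{nz}} f f∉E =
  let t , f≡t , ∣t∣≡2 = nonEdge⇒leaves f f∉E in
  spectrum-distances K char0 t ∣t∣≡2
    (principal (𝔇₂ (star (suc m) {{nz}})) (f ∷ Tree.edge (star (suc m) {{nz}})))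
    (principal-star {{nz}} f t f≡t ∣t∣≡2)
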